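{- Work in $\mathbf{ZF}$ (Zermelo-Fraenkel set theory without the axiom of choice). Suppose that the quasi-isometry relation on metric spaces is symmetric, i.e. for all metric spaces $S$ and $T$, if there exists a quasi-isometry $S\to T$ then there exists a quasi-isometry $T\to S$. Then the axiom of choice holds.
   Context: The implication is to be derived from the axioms of $\mathbf{ZF}$ alone. Quasi-isometry: for metric spaces $(S,d_S)$ and $(T,d_T)$, a function $f:S\to T$ is a quasi-isometry if there exists a natural number $N\ge 1$ such that $B(f(S),N)=T$ and for all $x,y\in S$, $\frac1N d_S(x,y)-N\le d_T(f(x),f(y))\le N d_S(x,y)+N$. Here, for $J\subseteq T$, $B(J,p)=\{x\in T: d_T(x,J)\le p\}$ is the closed $p$-neighborhood (with $d_T(x,\emptyset)=+\infty$). Axiom of choice (formulation): if $\mathcal Z$ is a nonempty set consisting of pairwise disjoint nonempty sets, then there exists a set $A$ such that $A\cap X$ has cardinality one for all $X\in\mathcal Z$. -}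

module Defs where

open import Algebra.Core using (Op₁; Op₂)
open import Algebra.Structures using (IsCommutativeRing)
open import Data.Fin.Base using (Fin)
open import Data.Nat.Base using (ℕ; suc)
open import Data.Product using (Σ; ∃; ∃₂; ∃!; _×_; _,_; proj₁)
open import Data.Sum.Base using (_⊎_)
open import Data.Vec.Base using (Vec; _∷_; lookup)
open import Function.Base using (_on_)
open import Function.Bundles using (_⇔_)
open import Function.Metric.Structures using (IsGeneralMetric)
open import Level using (Level) renaming (suc to lsuc)
open import Relation.Binary.Core using (Rel)
open import Relation.Binary.PropositionalEquality using (_≡_; _≢_; refl)
open import Relation.Binary.Structures using (IsTotalOrder)
open import Relation.Nullary using (¬_)
open import Relation.Unary using (Pred; Universal)

-- First-order formulas of set theory whose free variables are de Bruijn
-- indices below n.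

infix  8 _∈′_ _≡′_
infix  7 ¬′_
infixr 6 _∧′_
infixr 5 _∨′_
infixr 4 _⇒′_
infix  3 ∀′_ ∃′_

data Formula (n : ℕ) : Set where
  _∈′_ _≡′_      : Fin n → Fin n → Formula n
  ¬′_            : Formula n → Formula n
  _∧′_ _∨′_ _⇒′_ : Formula n → Formula n → Formula n
  ∀′_ ∃′_        : Formula (suc n) → Formula n

module Satisfaction {ℓ : Level} {V : Set ℓ} (_∈_ : Rel V ℓ) where

  infix 2 _⊨_

  _⊨_ : ∀ {n} → Vec V n → Formula n → Set ℓ
  ρ ⊨ i ∈′ j = lookup ρ i ∈ lookup ρ j
  ρ ⊨ i ≡′ j = lookup ρ i ≡ lookup ρ j
  ρ ⊨ ¬′ φ   = ¬ (ρ ⊨ φ)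
  ρ ⊨ φ ∧′ ψ = (ρ ⊨ φ) × (ρ ⊨ ψ)
  ρ ⊨ φ ∨′ ψ = (ρ ⊨ φ) ⊎ (ρ ⊨ ψ)
  ρ ⊨ φ ⇒′ ψ = (ρ ⊨ φ) → (ρ ⊨ ψ)
  ρ ⊨ ∀′ φ   = ∀ x → x ∷ ρ ⊨ φ
  ρ ⊨ ∃′ φ   = ∃ λ x → x ∷ ρ ⊨ φ

-- Models of ZF.  Separation and replacement range over first-order formulas
-- with parameters, not over arbitrary Agda predicates: the latter would let
-- the choice principle provable for Σ-types leak into the model.  Excluded
-- middle is part of the logic of ZF and is required for formulas only.

record ZF (ℓ : Level) : Set (lsuc ℓ) where
  infix 4 _∈_ _⊆_
  field
    V   : Set ℓ
    _∈_ : Rel V ℓ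

  open Satisfaction _∈_ public

  _⊆_ : Rel V ℓ
  a ⊆ b = ∀ x → x ∈ a → x ∈ b

  field
    excludedMiddle : ∀ {n} (φ : Formula n) (ρ : Vec V n) → ρ ⊨ φ ∨′ ¬′ φ

    extensionality : ∀ a b → (∀ x → x ∈ a ⇔ x ∈ b) → a ≡ b

    foundation : ∀ a → (∃ λ x → x ∈ a) →
                 ∃ λ x → x ∈ a × (∀ y → y ∈ x → ¬ (y ∈ a))

    pairing : ∀ a b → ∃ λ c → ∀ x → x ∈ c ⇔ (x ≡ a ⊎ x ≡ b)

    union : ∀ a → ∃ λ u → ∀ x → x ∈ u ⇔ (∃ λ y → y ∈ a × x ∈ y)

    powerSet : ∀ a → ∃ λ p → ∀ x → x ∈ p ⇔ x ⊆ a

    infinity : ∃ λ w →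
               (∃ λ e → e ∈ w × (∀ y → ¬ (y ∈ e))) ×
               (∀ x → x ∈ w → ∃ λ s → s ∈ w × (∀ y → y ∈ s ⇔ (y ∈ x ⊎ y ≡ x)))

    separation : ∀ {n} (φ : Formula (suc n)) (ρ : Vec V n) a →
                 ∃ λ b → ∀ x → x ∈ b ⇔ (x ∈ a × (x ∷ ρ ⊨ φ))

    replacement : ∀ {n} (φ : Formula (suc (suc n))) (ρ : Vec V n) a →
                  (∀ x → x ∈ a → ∀ y z → (x ∷ y ∷ ρ ⊨ φ) → (x ∷ z ∷ ρ ⊨ φ) → y ≡ z) →
                  ∃ λ b → ∀ y → y ∈ b ⇔ (∃ λ x → x ∈ a × (x ∷ y ∷ ρ ⊨ φ))

-- Everything below lives inside a fixed model: spaces, functions, metrics and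
-- real numbers are elements of V.

module Internal {ℓ : Level} (M : ZF ℓ) where
  open ZF M

  ⁅_,_⁆ : V → V → V
  ⁅ a , b ⁆ = proj₁ (pairing a b)

  ⟨_,_⟩ : V → V → V
  ⟨ a , b ⟩ = ⁅ ⁅ a , a ⁆ , ⁅ a , b ⁆ ⁆

  El : V → Set ℓ
  El A = Σ V (_∈ A)

  infix 4 _≈_
  _≈_ : ∀ {A} → Rel (El A) ℓ
  _≈_ = _≡_ on proj₁

  infixr 7 _⊠_
  _⊠_ : V → V → Pred V ℓ
  (A ⊠ B) p = ∃₂ λ x y → x ∈ A × y ∈ B × p ≡ ⟨ x , y ⟩

  -- The domain is a predicate so that A ⊠ B need not be formed as a set.
  record IsFunction (A : Pred V ℓ) (B f : V) : Set ℓ where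
    field
      graph : ∀ p → p ∈ f → ∃₂ λ x y → A x × y ∈ B × p ≡ ⟨ x , y ⟩
      value : ∀ x → A x → ∃! _≡_ λ y → y ∈ B × ⟨ x , y ⟩ ∈ f

  module _ {B f : V} where

    apply : ∀ {A} → IsFunction (_∈ A) B f → El A → El B
    apply isF (x , x∈A) =
      let y , (y∈B , _) , _ = IsFunction.value isF x x∈A in y , y∈B

    apply₂ : ∀ {A C} → IsFunction (A ⊠ C) B f → El A → El C → El B
    apply₂ isF (x , x∈A) (y , y∈C) =
      let z , (z∈B , _) , _ =
            IsFunction.value isF ⟨ x , y ⟩ (x , y , x∈A , y∈C , refl)
      in z , z∈B

  module Bounds {A : Set ℓ} (_≤_ : Rel A ℓ) where

    IsUpperBound IsLowerBound IsSupremum IsInfimum : Pred A ℓ → Pred A ℓ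
    IsUpperBound P u = ∀ x → P x → x ≤ u
    IsLowerBound P l = ∀ x → P x → l ≤ x
    IsSupremum P s   = IsUpperBound P s × (∀ u → IsUpperBound P u → s ≤ u)
    IsInfimum  P i   = IsLowerBound P i × (∀ l → IsLowerBound P l → l ≤ i)

  -- The real numbers: a Dedekind complete ordered field in the model.
  -- Completeness concerns the subsets of the field that are sets of the model.
  record Reals : Set ℓ where
    infix  8 -_
    infixl 7 _*_
    infixl 6 _+_
    infix  4 _≤_
    field
      R add mul leq : V
      0# 1#         : El R
      add-function  : IsFunction (R ⊠ R) R add
      mul-function  : IsFunction (R ⊠ R) R mul

    _+_ : Op₂ (El R)
    _+_ = apply₂ add-function

    _*_ : Op₂ (El R)
    _*_ = apply₂ mul-function

    _≤_ : Rel (El R) ℓ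
    x ≤ y = ⟨ proj₁ x , proj₁ y ⟩ ∈ leq

    open Bounds _≤_ public

    field
      -- Uniquely determined by add, hence not required to be an element of V.
      -_                : Op₁ (El R)
      isCommutativeRing : IsCommutativeRing _≈_ _+_ _*_ -_ 0# 1#
      0≉1               : ¬ (0# ≈ 1#)
      inverse           : ∀ x → ¬ (x ≈ 0#) → ∃ λ y → x * y ≈ 1#
      isTotalOrder      : IsTotalOrder _≈_ _≤_
      +-mono-≤          : ∀ x y z → x ≤ y → x + z ≤ y + z
      *-nonNegative     : ∀ x y → 0# ≤ x → 0# ≤ y → 0# ≤ x * y
      complete          : ∀ A → A ⊆ R →
                          (∃ λ x → x ∈ A) →
                          ∃ (IsUpperBound (λ x → proj₁ x ∈ A)) →
                          ∃ (IsSupremum (λ x → proj₁ x ∈ A))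

    -- The natural numbers of the model (possibly non-standard), as elements of
    -- R: those lying in every inductive set.
    IsNatural : Pred (El R) ℓ
    IsNatural n = ∀ I → proj₁ 0# ∈ I →
                  (∀ (x : El R) → proj₁ x ∈ I → proj₁ (x + 1#) ∈ I) →
                  proj₁ n ∈ I

  module Metric (ℝ : Reals) where
    open Reals ℝ

    record MetricSpace : Set ℓ where
      field
        Point         : V
        dist          : V
        dist-function : IsFunction (Point ⊠ Point) R dist

      d : El Point → El Point → El R
      d = apply₂ dist-function

      field
        isMetric : IsGeneralMetric _≈_ _≈_ _≤_ 0# _+_ d

      -- d(x , J) ≤ p, where d(x , J) is the infimum of the d(x , y) with y in J.
      -- For empty J there is no infimum in R, in accordance with d(x , ∅) = +∞.
      Neighbourhood : Pred (El Point) ℓ → El R → Pred (El Point) ℓ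
      Neighbourhood J p x =
        ∃ λ r → IsInfimum (λ s → ∃ λ y → J y × s ≈ d x y) r × r ≤ p

    record QuasiIsometry (S T : MetricSpace) : Set ℓ where
      private
        module S = MetricSpace S
        module T = MetricSpace T
      field
        map          : V
        map-function : IsFunction (_∈ S.Point) T.Point map

      f : El S.Point → El T.Point
      f = apply map-function

      field
        N 1/N     : El R
        natural   : IsNatural N
        1≤N       : 1# ≤ N
        N*1/N≈1   : N * 1/N ≈ 1#
        coarselyOnto : Universal (T.Neighbourhood (λ y → ∃ λ x → f x ≈ y) N)
        lower     : ∀ x y → 1/N * S.d x y + (- N) ≤ T.d (f x) (f y)
        upper     : ∀ x y → T.d (f x) (f y) ≤ N * S.d x y + N

    QuasiIsometrySymmetric : Set ℓ
    QuasiIsometrySymmetric = ∀ S T → QuasiIsometry S T → QuasiIsometry T S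

  AxiomOfChoice : Set ℓ
  AxiomOfChoice =
    ∀ 𝒵 →
    (∃ λ X → X ∈ 𝒵) →
    (∀ X → X ∈ 𝒵 → ∃ λ x → x ∈ X) →
    (∀ X Y → X ∈ 𝒵 → Y ∈ 𝒵 → X ≢ Y → ¬ (∃ λ x → x ∈ X × x ∈ Y)) →
    ∃ λ A → ∀ X → X ∈ 𝒵 → ∃! _≡_ λ x → x ∈ A × x ∈ X

-- Let 𝒵 be a family of disjoint nonempty sets and L = {2, 4, 16, 256, …}.  Let T
-- consist of the points (X , r) with X ∈ 𝒵 and r ∈ L, two distinct points being
-- at the distance r + s, the sum of their levels.  Blow every (X , r) up to a set
-- {(x , r) | x ∈ X} of diameter at most 1 to obtain S.  Forgetting x for the X
-- containing it is a quasi-isometry S → T; let g : T → S be a quasi-isometry.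
-- Consecutive levels being farther and farther apart, g preserves every large
-- level r₀.  For such a level, g(X , r₀) = (x , r₀) with x in a member Y of 𝒵; by
-- coarse injectivity Y determines X, and by coarse surjectivity every Y arises.
-- Hence these x form a choice set for 𝒵.

module Submission where

open import Defs
open import Algebra.Bundles using (CommutativeRing)
open import Algebra.Core using (Op₂)
open import Algebra.Structures using (IsCommutativeRing)
import Algebra.Properties.Ring as RingProperties
open import Data.Fin.Base using (Fin; zero; suc; lift; _↑ˡ_; _↑ʳ_)
open import Data.Fin.Patterns using (0F; 1F; 2F; 3F; 4F; 5F; 6F)
open import Data.Nat.Base as ℕ using (ℕ; suc)
open import Data.Product using (∃; ∃₂; ∃!; _×_; _,_; proj₁; proj₂)
open import Data.Product.Function.NonDependent.Propositional using (_×-⇔_)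
open import Data.Sum.Base using (_⊎_; inj₁; inj₂; [_,_]′; map)
open import Data.Sum.Function.Propositional using (_⊎-⇔_)
open import Data.Vec.Base using (Vec; []; _∷_; _++_; lookup)
open import Data.Vec.Properties using (lookup-++ˡ; lookup-++ʳ)
open import Function.Base using (_∘_; id)
open import Function.Bundles using (_⇔_; mk⇔; module Equivalence)
open import Function.Metric.Structures using (IsGeneralMetric)
open import Function.Related.TypeIsomorphisms using (→-cong-⇔; ¬-cong-⇔)
open import Level using (Level)
open import Relation.Binary.Bundles using (Poset)
import Relation.Binary.Construct.On as On
open import Relation.Binary.PropositionalEquality
  using (_≡_; _≢_; refl; sym; trans; cong; cong₂; subst; subst₂; isEquivalence)
import Relation.Binary.Reasoning.PartialOrder as PartialOrderReasoning
open import Relation.Binary.Structures using (IsTotalOrder)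
open import Relation.Nullary using (¬_; Dec; yes; no; contradiction)
open import Relation.Nullary.Decidable using (fromSum)
open import Relation.Unary using (Pred)

open Equivalence using (to; from)

-- Agda hands out witnesses of existential statements freely, but separation, replacement and
-- excluded middle hold for first-order formulas only. So every set that is formed and every
-- classical case distinction has to come from a formula with finitely many parameters; in
-- particular the choice set may depend on `g` only through its graph.
--
-- Many levels are needed because the constant of `g` is not known in advance: with a single level
-- both spaces would be bounded, and a constant map would be a quasi-isometry. Squaring is the
-- source of the levels for two reasons. The ratio between a level `z` and the next one is `z`,
-- which eventually exceeds every multiple of the constant; and the least set closed under squaring
-- is definable without recursion over the natural numbers of the model, which may be non-standard.
-- Adding the levels keeps a point of level r at distance at least r from every other class, so that
-- bounding distances to a base point bounds levels.

module _ {ℓ : Level} (M : ZF ℓ) where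
  open ZF M
  open Internal M

  -- Formulas with constants and pairs.

  infix  8 _∈″_ _≡″_
  infix  7 ¬″_
  infixr 6 _∧″_
  infixr 5 _∨″_
  infixr 4 _⇒″_
  infix  3 ∀″_ ∃″_
  infix  2 _⊩_

  -- Unlike Formula, these terms admit elements of the model as constants and
  -- unordered pairs, so that concrete sets can be described directly.

  data Term (n : ℕ) : Set ℓ where
    var    : Fin n → Term n
    con    : V → Term n
    ⁅_,_⁆″ : Term n → Term n → Term n

  data Form (n : ℕ) : Set ℓ where
    _∈″_ _≡″_      : Term n → Term n → Form n
    ¬″_            : Form n → Form n
    _∧″_ _∨″_ _⇒″_ : Form n → Form n → Form n
    ∀″_ ∃″_        : Form (suc n) → Form n

  ⟨_,_⟩″ : ∀ {n} → Term n → Term n → Term n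
  ⟨ s , t ⟩″ = ⁅ ⁅ s , s ⁆″ , ⁅ s , t ⁆″ ⁆″

  ⟦_⟧ : ∀ {n} → Term n → Vec V n → V
  ⟦ var i ⟧ ρ      = lookup ρ i
  ⟦ con a ⟧ ρ      = a
  ⟦ ⁅ s , t ⁆″ ⟧ ρ = ⁅ ⟦ s ⟧ ρ , ⟦ t ⟧ ρ ⁆

  _⊩_ : ∀ {n} → Vec V n → Form n → Set ℓ
  ρ ⊩ s ∈″ t = ⟦ s ⟧ ρ ∈ ⟦ t ⟧ ρ
  ρ ⊩ s ≡″ t = ⟦ s ⟧ ρ ≡ ⟦ t ⟧ ρ
  ρ ⊩ ¬″ φ   = ¬ (ρ ⊩ φ)
  ρ ⊩ φ ∧″ ψ = (ρ ⊩ φ) × (ρ ⊩ ψ)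
  ρ ⊩ φ ∨″ ψ = (ρ ⊩ φ) ⊎ (ρ ⊩ ψ)
  ρ ⊩ φ ⇒″ ψ = (ρ ⊩ φ) → (ρ ⊩ ψ)
  ρ ⊩ ∀″ φ   = ∀ x → x ∷ ρ ⊩ φ
  ρ ⊩ ∃″ φ   = ∃ λ x → x ∷ ρ ⊩ φ

  private
    variable
      j k m n : ℕ

    -- Constants are counted once per occurrence, so the slots of a compound split into those of its
    -- parts; `left` and `right` follow this splitting.
    #ᵗ : Term n → ℕ
    #ᵗ (var i)      = 0
    #ᵗ (con a)      = 1
    #ᵗ ⁅ s , t ⁆″   = #ᵗ s ℕ.+ #ᵗ t

    #ᶠ : Form n → ℕ
    #ᶠ (s ∈″ t) = #ᵗ s ℕ.+ #ᵗ t
    #ᶠ (s ≡″ t) = #ᵗ s ℕ.+ #ᵗ t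
    #ᶠ (¬″ φ)   = #ᶠ φ
    #ᶠ (φ ∧″ ψ) = #ᶠ φ ℕ.+ #ᶠ ψ
    #ᶠ (φ ∨″ ψ) = #ᶠ φ ℕ.+ #ᶠ ψ
    #ᶠ (φ ⇒″ ψ) = #ᶠ φ ℕ.+ #ᶠ ψ
    #ᶠ (∀″ φ)   = #ᶠ φ
    #ᶠ (∃″ φ)   = #ᶠ φ

    constantsᵗ : (t : Term n) → Vec V (#ᵗ t)
    constantsᵗ (var i)    = []
    constantsᵗ (con a)    = a ∷ []
    constantsᵗ ⁅ s , t ⁆″ = constantsᵗ s ++ constantsᵗ t

  constants : (φ : Form n) → Vec V (#ᶠ φ)
  constants (s ∈″ t) = constantsᵗ s ++ constantsᵗ t
  constants (s ≡″ t) = constantsᵗ s ++ constantsᵗ t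
  constants (¬″ φ)   = constants φ
  constants (φ ∧″ ψ) = constants φ ++ constants ψ
  constants (φ ∨″ ψ) = constants φ ++ constants ψ
  constants (φ ⇒″ ψ) = constants φ ++ constants ψ
  constants (∀″ φ)   = constants φ
  constants (∃″ φ)   = constants φ

  private
    left : ∀ j → (Fin (j ℕ.+ k) → Fin m) → Fin j → Fin m
    left {k = k} j c i = c (i ↑ˡ k)

    right : ∀ j → (Fin (j ℕ.+ k) → Fin m) → Fin k → Fin m
    right j c i = c (j ↑ʳ i)

    two : {A : Set} → (A → Fin m) → A → Fin (suc (suc m))
    two f i = suc (suc (f i))

    pair : Fin m → Fin m → Fin m → Formula m
    pair x a b = ∀′ ((zero ∈′ suc x ⇒′ zero ≡′ suc a ∨′ zero ≡′ suc b) ∧′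
                     (zero ≡′ suc a ∨′ zero ≡′ suc b ⇒′ zero ∈′ suc x))

    -- `Formula` has no function symbols: each component of a pair receives an existentially
    -- quantified name, and the pair is then characterised by its elements.
    hasValue : (t : Term n) → (Fin n → Fin m) → (Fin (#ᵗ t) → Fin m) →
            Fin m → Formula m
    hasValue (var i)    e c x = x ≡′ e i
    hasValue (con a)    e c x = x ≡′ c zero
    hasValue ⁅ s , t ⁆″ e c x =
      ∃′ ∃′ hasValue s (two e) (two (left (#ᵗ s) c)) zero ∧′
            hasValue t (two e) (two (right (#ᵗ s) c)) (suc zero) ∧′
            pair (suc (suc x)) zero (suc zero)

  -- Translation to Formula: e and c say where the free variables and the
  -- constants are found in the new environment.

  translate : (φ : Form n) → (Fin n → Fin m) → (Fin (#ᶠ φ) → Fin m) → Formula m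
  translate (s ∈″ t) e c =
    ∃′ ∃′ hasValue s (two e) (two (left (#ᵗ s) c)) zero ∧′
          hasValue t (two e) (two (right (#ᵗ s) c)) (suc zero) ∧′
          zero ∈′ suc zero
  translate (s ≡″ t) e c =
    ∃′ ∃′ hasValue s (two e) (two (left (#ᵗ s) c)) zero ∧′
          hasValue t (two e) (two (right (#ᵗ s) c)) (suc zero) ∧′
          zero ≡′ suc zero
  translate (¬″ φ)   e c = ¬′ translate φ e c
  translate (φ ∧″ ψ) e c = translate φ e (left (#ᶠ φ) c) ∧′ translate ψ e (right (#ᶠ φ) c)
  translate (φ ∨″ ψ) e c = translate φ e (left (#ᶠ φ) c) ∨′ translate ψ e (right (#ᶠ φ) c)
  translate (φ ⇒″ ψ) e c = translate φ e (left (#ᶠ φ) c) ⇒′ translate ψ e (right (#ᶠ φ) c)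
  translate (∀″ φ)   e c = ∀′ translate φ (lift 1 e) (suc ∘ c)
  translate (∃″ φ)   e c = ∃′ translate φ (lift 1 e) (suc ∘ c)

  private
    Agree : Vec V m → (Fin n → Fin m) → Vec V n → Set ℓ
    Agree σ f xs = ∀ i → lookup σ (f i) ≡ lookup xs i

    agree-left : ∀ (σ : Vec V m) (c : Fin (j ℕ.+ k) → Fin m)
                 (xs : Vec V j) (ys : Vec V k) →
                 Agree σ c (xs ++ ys) → Agree σ (left j c) xs
    agree-left σ c xs ys h i = trans (h _) (lookup-++ˡ xs ys i)

    agree-right : ∀ (σ : Vec V m) (c : Fin (j ℕ.+ k) → Fin m)
                  (xs : Vec V j) (ys : Vec V k) →
                  Agree σ c (xs ++ ys) → Agree σ (right j c) ys
    agree-right σ c xs ys h i = trans (h _) (lookup-++ʳ xs ys i)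

    agree-lift : ∀ {σ : Vec V m} {e : Fin n → Fin m} {ρ} x →
                 Agree σ e ρ → Agree (x ∷ σ) (lift 1 e) (x ∷ ρ)
    agree-lift x h zero    = refl
    agree-lift x h (suc i) = h i

    ∀-cong : ∀ {P Q : V → Set ℓ} → (∀ x → P x ⇔ Q x) → (∀ x → P x) ⇔ (∀ x → Q x)
    ∀-cong h = mk⇔ (λ p x → to (h x) (p x)) (λ q x → from (h x) (q x))

    ∃-cong : ∀ {P Q : V → Set ℓ} → (∀ x → P x ⇔ Q x) → ∃ P ⇔ ∃ Q
    ∃-cong h = mk⇔ (λ (x , p) → x , to (h x) p) (λ (x , q) → x , from (h x) q)

    -- The quantified names are forced to be `b` and `a`, so they can be substituted away. Atomic
    -- formulas and pairs are both of this shape.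
    at-values : ∀ {a b : V} {P Q A : V → V → Set ℓ} {B : Set ℓ} →
                (∀ y x → P y x ⇔ (x ≡ a)) → (∀ y x → Q y x ⇔ (y ≡ b)) → A b a ⇔ B →
                (∃₂ λ y x → P y x × Q y x × A y x) ⇔ B
    at-values {a} {b} {A = A} P⇔ Q⇔ A⇔B = mk⇔
      (λ (y , x , p , q , r) →
        to A⇔B (subst₂ A (to (Q⇔ y x) q) (to (P⇔ y x) p) r))
      (λ r → b , a , from (P⇔ b a) refl , from (Q⇔ b a) refl , from A⇔B r)

    pair-correct : ∀ (σ : Vec V m) x a b →
                   (σ ⊨ pair x a b) ⇔ (lookup σ x ≡ ⁅ lookup σ a , lookup σ b ⁆)
    pair-correct σ x a b = mk⇔
      (λ h → extensionality _ _ λ y → mk⇔ (from ∈⁅⁆ ∘ proj₁ (h y)) (proj₂ (h y) ∘ to ∈⁅⁆))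
      (λ h y → to ∈⁅⁆ ∘ subst (y ∈_) h , subst (y ∈_) (sym h) ∘ from ∈⁅⁆)
      where
      ∈⁅⁆ : ∀ {y} → y ∈ ⁅ lookup σ a , lookup σ b ⁆ ⇔ (y ≡ lookup σ a ⊎ y ≡ lookup σ b)
      ∈⁅⁆ = proj₂ (pairing _ _) _

    hasValue-correct : ∀ (t : Term n) {e : Fin n → Fin m} {c} {σ : Vec V m} {ρ} x →
                    Agree σ e ρ → Agree σ c (constantsᵗ t) →
                    (σ ⊨ hasValue t e c x) ⇔ (lookup σ x ≡ ⟦ t ⟧ ρ)
    hasValue-correct (var i) {σ = σ} x hₑ h =
      mk⇔ (λ p → trans p (hₑ i)) (λ p → trans p (sym (hₑ i)))
    hasValue-correct (con a) x hₑ h =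
      mk⇔ (λ p → trans p (h zero)) (λ p → trans p (sym (h zero)))
    hasValue-correct ⁅ s , t ⁆″ {c = c} {σ} {ρ} x hₑ h = at-values
      (λ _ _ → hasValue-correct s zero hₑ (agree-left σ c (constantsᵗ s) (constantsᵗ t) h))
      (λ _ _ → hasValue-correct t (suc zero) hₑ (agree-right σ c (constantsᵗ s) (constantsᵗ t) h))
      (pair-correct (⟦ s ⟧ ρ ∷ ⟦ t ⟧ ρ ∷ σ) (suc (suc x)) zero (suc zero))

    translate-correct : ∀ (φ : Form n) {e : Fin n → Fin m} {c} {σ : Vec V m} {ρ} →
                        Agree σ e ρ → Agree σ c (constants φ) →
                        (σ ⊨ translate φ e c) ⇔ (ρ ⊩ φ)
    translate-correct (s ∈″ t) {c = c} {σ} hₑ h = at-values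
      (λ _ _ → hasValue-correct s zero hₑ (agree-left σ c (constantsᵗ s) (constantsᵗ t) h))
      (λ _ _ → hasValue-correct t (suc zero) hₑ (agree-right σ c (constantsᵗ s) (constantsᵗ t) h))
      (mk⇔ id id)
    translate-correct (s ≡″ t) {c = c} {σ} hₑ h = at-values
      (λ _ _ → hasValue-correct s zero hₑ (agree-left σ c (constantsᵗ s) (constantsᵗ t) h))
      (λ _ _ → hasValue-correct t (suc zero) hₑ (agree-right σ c (constantsᵗ s) (constantsᵗ t) h))
      (mk⇔ id id)
    translate-correct (¬″ φ) hₑ h = ¬-cong-⇔ (translate-correct φ hₑ h)
    translate-correct (φ ∧″ ψ) {c = c} {σ} hₑ h =
      translate-correct φ hₑ (agree-left σ c (constants φ) (constants ψ) h) ×-⇔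
      translate-correct ψ hₑ (agree-right σ c (constants φ) (constants ψ) h)
    translate-correct (φ ∨″ ψ) {c = c} {σ} hₑ h =
      translate-correct φ hₑ (agree-left σ c (constants φ) (constants ψ) h) ⊎-⇔
      translate-correct ψ hₑ (agree-right σ c (constants φ) (constants ψ) h)
    translate-correct (φ ⇒″ ψ) {c = c} {σ} hₑ h = →-cong-⇔
      (translate-correct φ hₑ (agree-left σ c (constants φ) (constants ψ) h))
      (translate-correct ψ hₑ (agree-right σ c (constants φ) (constants ψ) h))
    translate-correct (∀″ φ) hₑ h = ∀-cong λ x → translate-correct φ (agree-lift x hₑ) h
    translate-correct (∃″ φ) hₑ h = ∃-cong λ x → translate-correct φ (agree-lift x hₑ) h

  abstract
    -- The source of all classical case distinctions below: excluded middle is applied to the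
    -- translation, with the constants appended to `ρ`.
    decide : ∀ (φ : Form n) ρ → Dec (ρ ⊩ φ)
    decide {n} φ ρ =
      let correct = translate-correct φ (lookup-++ˡ ρ (constants φ)) (lookup-++ʳ ρ (constants φ))
      in fromSum (map (to correct) (_∘ from correct)
           (excludedMiddle (translate φ (_↑ˡ #ᶠ φ) (n ↑ʳ_)) (ρ ++ constants φ)))

    separate : ∀ (φ : Form 1) a → ∃ λ b → ∀ x → x ∈ b ⇔ (x ∈ a × (x ∷ [] ⊩ φ))
    separate φ a =
      let b , ∈b = separation (translate φ (_↑ˡ #ᶠ φ) suc) (constants φ) a
          correct = λ x → translate-correct φ {σ = x ∷ constants φ} {x ∷ []}
                            (λ { zero → refl }) (λ _ → refl)
      in b , λ x → mk⇔
        (λ x∈b → let x∈a , h = to (∈b x) x∈b in x∈a , to (correct x) h)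
        (λ (x∈a , h) → from (∈b x) (x∈a , from (correct x) h))

  -- Pairs, products and functions inside the model.

  infix 4 _≟_
  _≟_ : (a b : V) → Dec (a ≡ b)
  a ≟ b = decide (con a ≡″ con b) []

  ∈⁅⁆ : ∀ {x a b} → x ∈ ⁅ a , b ⁆ ⇔ (x ≡ a ⊎ x ≡ b)
  ∈⁅⁆ = proj₂ (pairing _ _) _

  ⁅⁆-injective : ∀ {a b c d} → ⁅ a , b ⁆ ≡ ⁅ c , d ⁆ →
                 (a ≡ c × b ≡ d) ⊎ (a ≡ d × b ≡ c)
  ⁅⁆-injective {a} {b} {c} {d} eq
    with to ∈⁅⁆ (subst (a ∈_) eq (from ∈⁅⁆ (inj₁ refl)))
       | to ∈⁅⁆ (subst (b ∈_) eq (from ∈⁅⁆ (inj₂ refl)))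
       | to ∈⁅⁆ (subst (c ∈_) (sym eq) (from ∈⁅⁆ (inj₁ refl)))
       | to ∈⁅⁆ (subst (d ∈_) (sym eq) (from ∈⁅⁆ (inj₂ refl)))
  ... | inj₁ refl | inj₂ refl | _         | _         = inj₁ (refl , refl)
  ... | inj₂ refl | inj₁ refl | _         | _         = inj₂ (refl , refl)
  ... | inj₁ refl | inj₁ refl | _         | inj₁ refl = inj₁ (refl , refl)
  ... | inj₁ refl | inj₁ refl | _         | inj₂ refl = inj₁ (refl , refl)
  ... | inj₂ refl | inj₂ refl | inj₁ refl | _         = inj₁ (refl , refl)
  ... | inj₂ refl | inj₂ refl | inj₂ refl | _         = inj₁ (refl , refl)

  ⟨⟩-injective : ∀ {a b c d} → ⟨ a , b ⟩ ≡ ⟨ c , d ⟩ → a ≡ c × b ≡ d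
  ⟨⟩-injective eq with ⁅⁆-injective eq
  ... | inj₁ (aa≡cc , ab≡cd) with ⁅⁆-injective aa≡cc | ⁅⁆-injective ab≡cd
  ...   | inj₁ (refl , _) | inj₁ (_ , refl)    = refl , refl
  ...   | inj₁ (refl , _) | inj₂ (refl , refl) = refl , refl
  ...   | inj₂ (refl , _) | inj₁ (_ , refl)    = refl , refl
  ...   | inj₂ (refl , _) | inj₂ (refl , refl) = refl , refl
  ⟨⟩-injective eq | inj₂ (aa≡cd , ab≡cc) with ⁅⁆-injective aa≡cd | ⁅⁆-injective ab≡cc
  ...   | inj₁ (refl , refl) | inj₁ (_ , refl) = refl , refl
  ...   | inj₁ (refl , refl) | inj₂ (_ , refl) = refl , refl
  ...   | inj₂ (refl , refl) | inj₁ (_ , refl) = refl , refl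
  ...   | inj₂ (refl , refl) | inj₂ (_ , refl) = refl , refl

  infixr 7 _⊗_

  abstract
    product : ∀ A B → ∃ λ C → ∀ z → z ∈ C ⇔ (A ⊠ B) z
    product A B =
      let U , ∈U = union ⁅ A , B ⁆
          P , ∈P = powerSet U
          Q , ∈Q = powerSet P
          C , ∈C = separate
            (∃″ ∃″ var 1F ∈″ con A ∧″ var 0F ∈″ con B ∧″ var 2F ≡″ ⟨ var 1F , var 0F ⟩″) Q
          A⊆U = λ {x} x∈A → from (∈U x) (A , from ∈⁅⁆ (inj₁ refl) , x∈A)
          B⊆U = λ {x} x∈B → from (∈U x) (B , from ∈⁅⁆ (inj₂ refl) , x∈B)
          ⁅⁆∈P = λ {x} {y} (x∈U : x ∈ U) (y∈U : y ∈ U) → from (∈P ⁅ x , y ⁆) λ z z∈ →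
            case⁅⁆ z∈ x∈U y∈U
      in C , λ z → mk⇔
        (proj₂ ∘ to (∈C z))
        (λ { h@(x , y , x∈A , y∈B , refl) → from (∈C z) (from (∈Q z) (λ w w∈ →
           case⁅⁆ w∈ (⁅⁆∈P (A⊆U x∈A) (A⊆U x∈A)) (⁅⁆∈P (A⊆U x∈A) (B⊆U y∈B))) , h) })
      where
      case⁅⁆ : ∀ {x y z D} → z ∈ ⁅ x , y ⁆ → x ∈ D → y ∈ D → z ∈ D
      case⁅⁆ z∈ x∈D y∈D with to ∈⁅⁆ z∈
      ... | inj₁ refl = x∈D
      ... | inj₂ refl = y∈D

    _⊗_ : V → V → V
    A ⊗ B = proj₁ (product A B)

    ∈⊗ : ∀ {A B z} → z ∈ A ⊗ B ⇔ (A ⊠ B) z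
    ∈⊗ = proj₂ (product _ _) _

  module _ {A : Pred V ℓ} {B f : V} (isF : IsFunction A B f) where
    open IsFunction isF

    image : ∀ x → A x → V
    image x a = proj₁ (value x a)

    image-∈ : ∀ x a → ⟨ x , image x a ⟩ ∈ f
    image-∈ x a = proj₂ (proj₁ (proj₂ (value x a)))

    -- Turns the graph memberships that formulas speak of into equations. Uniqueness of values
    -- ranges over `B`, and `graph` supplies the missing `y ∈ B`.
    ∈⇒image : ∀ {x y} (a : A x) → ⟨ x , y ⟩ ∈ f → y ≡ image x a
    ∈⇒image {x} {y} a xy∈f =
      let _ , _ , _ , y∈B , eq = graph _ xy∈f
      in sym (proj₂ (proj₂ (value x a))
                    (subst (_∈ B) (sym (proj₂ (⟨⟩-injective eq))) y∈B , xy∈f))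

    -- Proofs of `A x` are not assumed to be unique; uniqueness of values makes the image
    -- independent of them.
    image-cong : ∀ {x y} (a : A x) (b : A y) → x ≡ y → image x a ≡ image y b
    image-cong {x} a b refl = ∈⇒image b (image-∈ x a)

  -- A function of the model from an Agda function with definable graph;
  -- applying it computes.
  module Definable (A : Pred V ℓ) (dom B : V) (∈dom : ∀ x → x ∈ dom ⇔ A x)
                   (F : ∀ x → A x → El B) (φ : Form 1)
                   (φ⇔F : ∀ x (a : A x) y → (⟨ x , y ⟩ ∷ [] ⊩ φ) ⇔ (y ≡ proj₁ (F x a)))
                   where

    set : V
    set = proj₁ (separate φ (dom ⊗ B))

    isFunction : IsFunction A B set
    isFunction = record
      { graph = λ p p∈set →
          let x , y , x∈dom , y∈B , eq = to ∈⊗ (proj₁ (to (∈set p) p∈set))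
          in x , y , to (∈dom x) x∈dom , y∈B , eq
      ; value = λ x a → let y , y∈B = F x a in
          y ,
          (y∈B , from (∈set _) (from ∈⊗ (x , y , from (∈dom x) a , y∈B , refl) ,
                                from (φ⇔F x a y) refl)) ,
          λ (_ , xz∈set) → sym (to (φ⇔F x a _) (proj₂ (to (∈set _) xz∈set)))
      }
      where ∈set = proj₂ (separate φ (dom ⊗ B))

  -- Arithmetic of the ordered field.

  module _ (ℝ : Reals) where
    private module ℝ = Reals ℝ
    open ℝ hiding
      (_≤_; _+_; _*_; isCommutativeRing; isTotalOrder; +-mono-≤; *-nonNegative)
    open Metric ℝ

    infixl 7 _*_
    infixl 6 _+_
    infix  4 _≤_

    -- A wrapper from which the two numbers can be inferred: ℝ._≤_ only mentions
    -- their first components.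
    record _≤_ (x y : El R) : Set ℓ where
      constructor ⌈_⌉
      field ⌊_⌋ : x ℝ.≤ y
    open _≤_ public

    -- For the same reason sums and products are not unfolded.
    abstract
      _+_ _*_ : Op₂ (El R)
      _+_ = ℝ._+_
      _*_ = ℝ._*_

      +≈ℝ+ : ∀ x y → x + y ≈ x ℝ.+ y
      +≈ℝ+ x y = refl

      *≈ℝ* : ∀ x y → x * y ≈ x ℝ.* y
      *≈ℝ* x y = refl

      ⌊≤+⌋ : ∀ x y z → x ≤ y + z → x ℝ.≤ y ℝ.+ z
      ⌊≤+⌋ x y z ⌈ h ⌉ = h

      ⌊*+≤⌋ : ∀ w x y z → w * x + y ≤ z → w ℝ.* x ℝ.+ y ℝ.≤ z
      ⌊*+≤⌋ w x y z ⌈ h ⌉ = h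

      ⌈*+≤⌉ : ∀ w x y z → w ℝ.* x ℝ.+ y ℝ.≤ z → w * x + y ≤ z
      ⌈*+≤⌉ w x y z h = ⌈ h ⌉

      ⌊≤*+⌋ : ∀ w x y z → w ≤ x * y + z → w ℝ.≤ x ℝ.* y ℝ.+ z
      ⌊≤*+⌋ w x y z ⌈ h ⌉ = h

      ⌈≤*+⌉ : ∀ w x y z → w ℝ.≤ x ℝ.* y ℝ.+ z → w ≤ x * y + z
      ⌈≤*+⌉ w x y z h = ⌈ h ⌉

      isCommutativeRing : IsCommutativeRing _≈_ _+_ _*_ -_ 0# 1#
      isCommutativeRing = ℝ.isCommutativeRing

      ∈add : ∀ x y → ⟨ ⟨ proj₁ x , proj₁ y ⟩ , proj₁ (x + y) ⟩ ∈ add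
      ∈add (x , x∈R) (y , y∈R) = image-∈ add-function ⟨ x , y ⟩ (x , y , x∈R , y∈R , refl)

      ∈add⇒≡ : ∀ x y {w} → ⟨ ⟨ proj₁ x , proj₁ y ⟩ , w ⟩ ∈ add → w ≡ proj₁ (x + y)
      ∈add⇒≡ (x , x∈R) (y , y∈R) = ∈⇒image add-function (x , y , x∈R , y∈R , refl)

      ∈mul : ∀ x y → ⟨ ⟨ proj₁ x , proj₁ y ⟩ , proj₁ (x * y) ⟩ ∈ mul
      ∈mul (x , x∈R) (y , y∈R) = image-∈ mul-function ⟨ x , y ⟩ (x , y , x∈R , y∈R , refl)

      ∈mul⇒≡ : ∀ x y {w} → ⟨ ⟨ proj₁ x , proj₁ y ⟩ , w ⟩ ∈ mul → w ≡ proj₁ (x * y)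
      ∈mul⇒≡ (x , x∈R) (y , y∈R) = ∈⇒image mul-function (x , y , x∈R , y∈R , refl)

      +-monoˡ-≤ : ∀ {x y} z → x ≤ y → x + z ≤ y + z
      +-monoˡ-≤ z ⌈ x≤y ⌉ = ⌈ ℝ.+-mono-≤ _ _ z x≤y ⌉

      *-nonNegative : ∀ {x y} → 0# ≤ x → 0# ≤ y → 0# ≤ x * y
      *-nonNegative ⌈ 0≤x ⌉ ⌈ 0≤y ⌉ = ⌈ ℝ.*-nonNegative _ _ 0≤x 0≤y ⌉

    commutativeRing : CommutativeRing ℓ ℓ
    commutativeRing = record { isCommutativeRing = isCommutativeRing }

    open CommutativeRing commutativeRing public
      using (+-cong; +-congˡ; +-congʳ; +-comm; +-assoc; +-identityˡ; +-identityʳ;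
             *-congˡ; *-congʳ; *-comm; *-assoc; *-identityˡ;
             -‿cong; -‿inverseˡ; -‿inverseʳ; distribˡ; distribʳ)

    open RingProperties (CommutativeRing.ring commutativeRing) public
      using (-‿distribˡ-*; -‿involutive)

    private module ≤ᴿ = IsTotalOrder ℝ.isTotalOrder

    ≤-reflexive : ∀ {x y} → x ≈ y → x ≤ y
    ≤-reflexive {x} {y} x≈y = ⌈ ≤ᴿ.reflexive {x} {y} x≈y ⌉

    ≤-refl : ∀ {x} → x ≤ x
    ≤-refl = ≤-reflexive refl

    ≤-trans : ∀ {x y z} → x ≤ y → y ≤ z → x ≤ z
    ≤-trans {x} {y} {z} ⌈ x≤y ⌉ ⌈ y≤z ⌉ = ⌈ ≤ᴿ.trans {x} {y} {z} x≤y y≤z ⌉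

    ≤-antisym : ∀ {x y} → x ≤ y → y ≤ x → x ≈ y
    ≤-antisym {x} {y} ⌈ x≤y ⌉ ⌈ y≤x ⌉ = ≤ᴿ.antisym {x} {y} x≤y y≤x

    ≤-total : ∀ x y → x ≤ y ⊎ y ≤ x
    ≤-total x y = map ⌈_⌉ ⌈_⌉ (≤ᴿ.total x y)

    poset : Poset ℓ ℓ ℓ
    poset = record
      { _≤_ = _≤_
      ; isPartialOrder = record
        { isPreorder = record
          { isEquivalence = CommutativeRing.isEquivalence commutativeRing
          ; reflexive = ≤-reflexive
          ; trans = ≤-trans
          }
        ; antisym = ≤-antisym
        }
      }

    open PartialOrderReasoning poset

    +-monoʳ-≤ : ∀ {x y} z → x ≤ y → z + x ≤ z + y
    +-monoʳ-≤ {x} {y} z x≤y = begin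
      z + x ≈⟨ +-comm z x ⟩
      x + z ≤⟨ +-monoˡ-≤ z x≤y ⟩
      y + z ≈⟨ +-comm y z ⟩
      z + y ∎

    +-mono-≤ : ∀ {x y u v} → x ≤ y → u ≤ v → x + u ≤ y + v
    +-mono-≤ x≤y u≤v = ≤-trans (+-monoˡ-≤ _ x≤y) (+-monoʳ-≤ _ u≤v)

    x+z-z≈x : ∀ x z → x + z + - z ≈ x
    x+z-z≈x x z = trans (+-assoc x z (- z)) (trans (+-congˡ (-‿inverseʳ z)) (+-identityʳ x))

    x-z+z≈x : ∀ x z → x + - z + z ≈ x
    x-z+z≈x x z = trans (+-assoc x (- z) z) (trans (+-congˡ (-‿inverseˡ z)) (+-identityʳ x))

    +-cancelʳ-≤ : ∀ {x y} z → x + z ≤ y + z → x ≤ y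
    +-cancelʳ-≤ {x} {y} z h = begin
      x           ≈⟨ x+z-z≈x x z ⟨
      x + z + - z ≤⟨ +-monoˡ-≤ (- z) h ⟩
      y + z + - z ≈⟨ x+z-z≈x y z ⟩
      y           ∎

    x+z≤y⇒x≤y-z : ∀ {x y} z → x + z ≤ y → x ≤ y + - z
    x+z≤y⇒x≤y-z {x} {y} z h = begin
      x           ≈⟨ x+z-z≈x x z ⟨
      x + z + - z ≤⟨ +-monoˡ-≤ (- z) h ⟩
      y + - z     ∎

    x-z≤y⇒x≤y+z : ∀ {x y} z → x + - z ≤ y → x ≤ y + z
    x-z≤y⇒x≤y+z {x} {y} z h = begin
      x           ≈⟨ x-z+z≈x x z ⟨
      x + - z + z ≤⟨ +-monoˡ-≤ z h ⟩
      y + z       ∎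

    x≤y+z⇒x-z≤y : ∀ {x y} z → x ≤ y + z → x + - z ≤ y
    x≤y+z⇒x-z≤y {x} {y} z h = begin
      x + - z     ≤⟨ +-monoˡ-≤ (- z) h ⟩
      y + z + - z ≈⟨ x+z-z≈x y z ⟩
      y           ∎

    x≤x+y : ∀ {x y} → 0# ≤ y → x ≤ x + y
    x≤x+y {x} {y} 0≤y = begin
      x      ≈⟨ +-identityʳ x ⟨
      x + 0# ≤⟨ +-monoʳ-≤ x 0≤y ⟩
      x + y  ∎

    x≤y+x : ∀ {x y} → 0# ≤ y → x ≤ y + x
    x≤y+x {x} {y} 0≤y = ≤-trans (x≤x+y 0≤y) (≤-reflexive (+-comm x y))

    *-monoʳ-≤ : ∀ {x y c} → 0# ≤ c → x ≤ y → c * x ≤ c * y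
    *-monoʳ-≤ {x} {y} {c} 0≤c x≤y = begin
      c * x                    ≈⟨ +-identityˡ (c * x) ⟨
      0# + c * x               ≤⟨ +-monoˡ-≤ (c * x) (*-nonNegative 0≤c 0≤y-x) ⟩
      c * (y + - x) + c * x    ≈⟨ distribˡ c (y + - x) x ⟨
      c * (y + - x + x)        ≈⟨ *-congˡ (x-z+z≈x y x) ⟩
      c * y                    ∎
      where
      0≤y-x : 0# ≤ y + - x
      0≤y-x = x+z≤y⇒x≤y-z x (≤-trans (≤-reflexive (+-identityˡ x)) x≤y)

    *-monoˡ-≤ : ∀ {x y c} → 0# ≤ c → x ≤ y → x * c ≤ y * c
    *-monoˡ-≤ {x} {y} {c} 0≤c x≤y = begin
      x * c ≈⟨ *-comm x c ⟩
      c * x ≤⟨ *-monoʳ-≤ 0≤c x≤y ⟩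
      c * y ≈⟨ *-comm c y ⟩
      y * c ∎

    *-mono-≤ : ∀ {x y u v} → 0# ≤ x → 0# ≤ v → x ≤ y → u ≤ v → x * u ≤ y * v
    *-mono-≤ 0≤x 0≤v x≤y u≤v = ≤-trans (*-monoʳ-≤ 0≤x u≤v) (*-monoˡ-≤ 0≤v x≤y)

    0≤1 : 0# ≤ 1#
    0≤1 = [ id , (λ 1≤0 → begin
      0#          ≤⟨ *-nonNegative (0≤-1 1≤0) (0≤-1 1≤0) ⟩
      - 1# * - 1# ≈⟨ -‿distribˡ-* 1# (- 1#) ⟨
      - (1# * - 1#) ≈⟨ -‿cong (*-identityˡ (- 1#)) ⟩
      - - 1#      ≈⟨ -‿involutive 1# ⟩
      1#          ∎) ]′ (≤-total 0# 1#)
      where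
      0≤-1 : 1# ≤ 0# → 0# ≤ - 1#
      0≤-1 1≤0 = begin
        0#        ≈⟨ -‿inverseʳ 1# ⟨
        1# + - 1# ≤⟨ +-monoˡ-≤ (- 1#) 1≤0 ⟩
        0# + - 1# ≈⟨ +-identityˡ (- 1#) ⟩
        - 1#      ∎

    x+1≰x : ∀ {x} → ¬ (x + 1# ≤ x)
    x+1≰x {x} h = 0≉1 (≤-antisym 0≤1 (+-cancelʳ-≤ x (begin
      1# + x ≈⟨ +-comm 1# x ⟩
      x + 1# ≤⟨ h ⟩
      x      ≈⟨ +-identityˡ x ⟨
      0# + x ∎)))

    1≰0 : ¬ (1# ≤ 0#)
    1≰0 1≤0 = 0≉1 (≤-antisym 0≤1 1≤0)

    x≤y*x : ∀ {x y} → 0# ≤ x → 1# ≤ y → x ≤ y * x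
    x≤y*x {x} {y} 0≤x 1≤y = begin
      x      ≈⟨ *-identityˡ x ⟨
      1# * x ≤⟨ *-monoˡ-≤ 0≤x 1≤y ⟩
      y * x  ∎

    x≤x*y : ∀ {x y} → 0# ≤ x → 1# ≤ y → x ≤ x * y
    x≤x*y 0≤x 1≤y = ≤-trans (x≤y*x 0≤x 1≤y) (≤-reflexive (*-comm _ _))

    -- The levels: gaps and unboundedness.

    2# : El R
    2# = 1# + 1#

    x+x≈2x : ∀ x → x + x ≈ 2# * x
    x+x≈2x x = sym (trans (distribʳ x 1# 1#)
      (+-cong {1# * x} {x} {1# * x} {x} (*-identityˡ x) (*-identityˡ x)))

    1≤2 : 1# ≤ 2#
    1≤2 = x≤x+y 0≤1

    -- The levels 2, 4, 16, 256, …: the least subset of R that contains 2 and is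
    -- closed under squaring.
    levels : ∃ λ L → ∀ x → x ∈ L ⇔
      (x ∈ R × (∀ I → proj₁ 2# ∈ I →
                     (∀ y w → y ∈ I → ⟨ ⟨ y , y ⟩ , w ⟩ ∈ mul → w ∈ I) → x ∈ I))
    levels = separate
      (∀″ con (proj₁ 2#) ∈″ var 0F ⇒″
          (∀″ ∀″ var 1F ∈″ var 2F ⇒″ ⟨ ⟨ var 1F , var 1F ⟩″ , var 0F ⟩″ ∈″ con mul ⇒″
                 var 0F ∈″ var 2F) ⇒″
          var 1F ∈″ var 0F)
      R

    L : V
    L = proj₁ levels

    L⊆R : ∀ {x} → x ∈ L → x ∈ R
    L⊆R x∈L = proj₁ (to (proj₂ levels _) x∈L)

    2∈L : proj₁ 2# ∈ L
    2∈L = from (proj₂ levels _) (proj₂ 2# , λ I 2∈I _ → 2∈I)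

    *-closed-L : ∀ x → proj₁ x ∈ L → proj₁ (x * x) ∈ L
    *-closed-L x x∈L = from (proj₂ levels _) (proj₂ (x * x) , λ I 2∈I step →
      step (proj₁ x) _ (proj₂ (to (proj₂ levels _) x∈L) I 2∈I step) (∈mul x x))

    -- Minimality of `L` concerns sets of the model, so the property must be a formula, from which
    -- such a set can be separated.
    L-induction : (φ : Form 1) → (proj₁ 2# ∷ [] ⊩ φ) →
                  (∀ x → proj₁ x ∈ L → (proj₁ x ∷ [] ⊩ φ) → (proj₁ (x * x) ∷ [] ⊩ φ)) →
                  ∀ x → x ∈ L → (x ∷ [] ⊩ φ)
    L-induction φ base step x x∈L =
      proj₂ (to (∈I x) (proj₂ (to (proj₂ levels x) x∈L) I (from (∈I _) (2∈L , base)) closed))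
      where
      I = proj₁ (separate φ L)
      ∈I = proj₂ (separate φ L)

      closed : ∀ y w → y ∈ I → ⟨ ⟨ y , y ⟩ , w ⟩ ∈ mul → w ∈ I
      closed y w y∈I yyw∈mul =
        let y∈L , φy = to (∈I y) y∈I
            y′ = y , L⊆R y∈L
        in subst (_∈ I) (sym (∈mul⇒≡ y′ y′ yyw∈mul))
             (from (∈I _) (*-closed-L y′ y∈L , step y′ y∈L φy))

    0≤2 : 0# ≤ 2#
    0≤2 = ≤-trans 0≤1 1≤2

    2≤level : ∀ x → proj₁ x ∈ L → 2# ≤ x
    2≤level (x , _) x∈L = ⌈ L-induction (⟨ con (proj₁ 2#) , var 0F ⟩″ ∈″ con leq) ⌊ ≤-refl {2#} ⌋
      (λ y _ 2≤y → ⌊ ≤-trans {2#} {y} {y * y} ⌈ 2≤y ⌉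
        (x≤x*y (≤-trans 0≤2 ⌈ 2≤y ⌉) (≤-trans 1≤2 ⌈ 2≤y ⌉)) ⌋) x x∈L ⌉

    1≤level : ∀ x → proj₁ x ∈ L → 1# ≤ x
    1≤level x x∈L = ≤-trans 1≤2 (2≤level x x∈L)

    0≤level : ∀ x → proj₁ x ∈ L → 0# ≤ x
    0≤level x x∈L = ≤-trans 0≤1 (1≤level x x∈L)

    square-mono : ∀ {x y} → 0# ≤ x → x ≤ y → x * x ≤ y * y
    square-mono 0≤x x≤y = *-mono-≤ 0≤x (≤-trans 0≤x x≤y) x≤y x≤y

    private
      Gap : El R → El R → Set ℓ
      Gap c y = y ≤ c ⊎ c * c ≤ y

      gap-induction : ∀ c → Gap c 2# →
                      (∀ y → proj₁ y ∈ L → Gap c y → Gap c (y * y)) →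
                      ∀ y → proj₁ y ∈ L → Gap c y
      gap-induction c base step (y , _) y∈L = map ⌈_⌉ ⌈_⌉
        (L-induction (⟨ var 0F , con (proj₁ c) ⟩″ ∈″ con leq ∨″
                      ⟨ con (proj₁ (c * c)) , var 0F ⟩″ ∈″ con leq)
          (map ⌊_⌋ ⌊_⌋ base)
          (λ z z∈L → map ⌊_⌋ ⌊_⌋ ∘ step z z∈L ∘ map ⌈_⌉ ⌈_⌉) y y∈L)

    -- Induction on `x` with `y` quantified inside the formula; the inner induction distinguishes
    -- whether `y` is 2 or the square of a level `z`. In the base case squares of levels are at
    -- least 4. In the step, squaring carries both alternatives for `z` and `x` over to their
    -- squares.
    level-gap : ∀ x y → proj₁ x ∈ L → proj₁ y ∈ L → y ≤ x ⊎ x * x ≤ y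
    level-gap x y x∈L y∈L = unfold {x} {y} (L-induction
      (∀″ var 0F ∈″ con L ⇒″
          ⟨ var 0F , var 1F ⟩″ ∈″ con leq ∨″
          (∃″ ⟨ ⟨ var 2F , var 2F ⟩″ , var 0F ⟩″ ∈″ con mul ∧″
              ⟨ var 0F , var 1F ⟩″ ∈″ con leq))
      (λ y y∈L → fold {2#} {y , L⊆R y∈L} (gap-induction 2# (inj₁ ≤-refl)
        (λ z z∈L _ → inj₂ (square-mono 0≤2 (2≤level z z∈L)))
        _ y∈L))
      (λ x x∈L gap y y∈L → fold {x * x} {y , L⊆R y∈L} (gap-induction (x * x)
        (inj₁ (≤-trans (2≤level x x∈L) (x≤x*y (0≤level x x∈L) (1≤level x x∈L))))
        (λ z z∈L _ → map
          (square-mono (0≤level z z∈L))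
          (square-mono (*-nonNegative (0≤level x x∈L) (0≤level x x∈L)))
          (unfold {x} {z} (gap (proj₁ z) z∈L)))
        _ y∈L))
      (proj₁ x) x∈L (proj₁ y) y∈L)
      where
      -- In the outer induction `c` is a variable, so its square is no constant and has to be named
      -- through the graph `mul`.
      fold : ∀ {c y : El R} → y ≤ c ⊎ c * c ≤ y →
             ⟨ proj₁ y , proj₁ c ⟩ ∈ leq ⊎
             (∃ λ w → ⟨ ⟨ proj₁ c , proj₁ c ⟩ , w ⟩ ∈ mul × ⟨ w , proj₁ y ⟩ ∈ leq)
      fold {c} = map ⌊_⌋ λ cc≤y → proj₁ (c * c) , ∈mul c c , ⌊ cc≤y ⌋

      unfold : ∀ {c y : El R} →
               ⟨ proj₁ y , proj₁ c ⟩ ∈ leq ⊎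
               (∃ λ w → ⟨ ⟨ proj₁ c , proj₁ c ⟩ , w ⟩ ∈ mul × ⟨ w , proj₁ y ⟩ ∈ leq) →
               y ≤ c ⊎ c * c ≤ y
      unfold {c} {y} = map ⌈_⌉ λ (w , ccw∈mul , w≤y) →
        ⌈ subst (λ w → ⟨ w , proj₁ y ⟩ ∈ leq) (∈mul⇒≡ c c ccw∈mul) w≤y ⌉

    abstract
      -- If `L` had a supremum s, then x + 1 ≤ 2x ≤ x² ≤ s for every level x, and s - 1 would be an
      -- upper bound as well.
      levels-unbounded : ∀ c → ∃ λ x → proj₁ x ∈ L × c ≤ x
      levels-unbounded c
        with decide (∃″ var 0F ∈″ con L ∧″ ⟨ con (proj₁ c) , var 0F ⟩″ ∈″ con leq) []
      ... | yes (x , x∈L , c≤x) = (x , L⊆R x∈L) , x∈L , ⌈ c≤x ⌉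
      ... | no none =
        let s , upper , least = complete L (λ _ → L⊆R) (_ , 2∈L) (c , bounded)
            s-1-upper : IsUpperBound (λ x → proj₁ x ∈ L) (s + - 1#)
            s-1-upper x x∈L = ⌊ x+z≤y⇒x≤y-z 1# (begin
              x + 1#       ≤⟨ +-monoʳ-≤ x (1≤level x x∈L) ⟩
              x + x        ≈⟨ x+x≈2x x ⟩
              2# * x       ≤⟨ *-monoˡ-≤ (0≤level x x∈L) (2≤level x x∈L) ⟩
              x * x        ≤⟨ ⌈ upper (x * x) (*-closed-L x x∈L) ⌉ ⟩
              s            ∎) ⌋
        in contradiction (begin
          s + 1#          ≤⟨ +-monoˡ-≤ 1# ⌈ least (s + - 1#) s-1-upper ⌉ ⟩
          s + - 1# + 1#   ≈⟨ x-z+z≈x s 1# ⟩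
          s               ∎) x+1≰x
        where
        bounded : IsUpperBound (λ x → proj₁ x ∈ L) c
        bounded x x∈L =
          [ ⌊_⌋ , (λ c≤x → contradiction (proj₁ x , x∈L , ⌊ c≤x ⌋) none) ]′ (≤-total x c)

    -- Metric spaces graded by levels.

    module _ {B : V} where

      abstract
        level : El (B ⊗ L) → El R
        level (q , q∈) = let _ , r , _ , r∈L , _ = to ∈⊗ q∈ in r , L⊆R r∈L

        level∈L : ∀ q → proj₁ (level q) ∈ L
        level∈L (q , q∈) = let _ , _ , _ , r∈L , _ = to ∈⊗ q∈ in r∈L

        level-⟨⟩ : ∀ q {X r} → proj₁ q ≡ ⟨ X , r ⟩ → proj₁ (level q) ≡ r
        level-⟨⟩ (q , q∈) eq =
          let _ , _ , _ , _ , eq′ = to ∈⊗ q∈ in proj₂ (⟨⟩-injective (trans (sym eq′) eq))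

        level-cong : ∀ {p q : El (B ⊗ L)} → p ≈ q → level p ≈ level q
        level-cong {p} {q , q∈} eq =
          let _ , _ , _ , _ , eq′ = to ∈⊗ q∈ in level-⟨⟩ p (trans eq eq′)

    -- Points with the same image under κ are within distance 1 of each other; any
    -- other distance is the sum of the two levels.
    module Space (B P κ : V) (κ-function : IsFunction (_∈ P) (B ⊗ L) κ) where

      class : El P → El (B ⊗ L)
      class = apply κ-function

      lev : El P → El R
      lev p = level (class p)

      0≤lev : ∀ p → 0# ≤ lev p
      0≤lev p = 0≤level (lev p) (level∈L (class p))

      1≤lev : ∀ p → 1# ≤ lev p
      1≤lev p = 1≤level (lev p) (level∈L (class p))

      -- A bridge between the decisions that compute `distance` and the formula `distForm`. The case
      -- `same` is separate from `near` because a metric vanishes on the diagonal.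
      data Dist (p q : El P) (v : V) : Set ℓ where
        same : p ≈ q → v ≡ proj₁ 0# → Dist p q v
        near : ¬ p ≈ q → class p ≈ class q → v ≡ proj₁ 1# → Dist p q v
        far  : ¬ class p ≈ class q → v ≡ proj₁ (lev p + lev q) → Dist p q v

      class-cong : ∀ p q → p ≈ q → class p ≈ class q
      class-cong (_ , p∈) (_ , q∈) = image-cong κ-function p∈ q∈

      abstract
        distance : El P → El P → El R
        distance p q with proj₁ p ≟ proj₁ q | proj₁ (class p) ≟ proj₁ (class q)
        ... | yes _ | _     = 0#
        ... | no _  | yes _ = 1#
        ... | no _  | no _  = lev p + lev q

        distance-Dist : ∀ p q → Dist p q (proj₁ (distance p q))
        distance-Dist p q with proj₁ p ≟ proj₁ q | proj₁ (class p) ≟ proj₁ (class q)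
        ... | yes p≈q | _        = same p≈q refl
        ... | no p≉q  | yes c≈c′ = near p≉q c≈c′ refl
        ... | no _    | no c≉c′  = far c≉c′ refl

      Dist-unique : ∀ p q {v w} → Dist p q v → Dist p q w → v ≡ w
      Dist-unique p q (same _ v≡)     (same _ w≡)     = trans v≡ (sym w≡)
      Dist-unique p q (near _ _ v≡)   (near _ _ w≡)   = trans v≡ (sym w≡)
      Dist-unique p q (far _ v≡)      (far _ w≡)      = trans v≡ (sym w≡)
      Dist-unique p q (same p≈q _)    (near p≉q _ _)  = contradiction p≈q p≉q
      Dist-unique p q (same p≈q _)    (far c≉c′ _)    = contradiction (class-cong p q p≈q) c≉c′
      Dist-unique p q (near p≉q _ _)  (same p≈q _)    = contradiction p≈q p≉q
      Dist-unique p q (near _ c≈c′ _) (far c≉c′ _)    = contradiction c≈c′ c≉c′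
      Dist-unique p q (far c≉c′ _)    (same p≈q _)    = contradiction (class-cong p q p≈q) c≉c′
      Dist-unique p q (far c≉c′ _)    (near _ c≈c′ _) = contradiction c≈c′ c≉c′

      Dist-sym : ∀ p q {v} → Dist p q v → Dist q p v
      Dist-sym p q (same p≈q v≡)      = same (sym p≈q) v≡
      Dist-sym p q (near p≉q c≈c′ v≡) = near (p≉q ∘ sym) (sym c≈c′) v≡
      Dist-sym p q (far c≉c′ v≡)      = far (c≉c′ ∘ sym) (trans v≡ (+-comm (lev p) (lev q)))

      -- The formula language has no terms for `class` and `lev`. Equality of classes becomes a
      -- common value under `κ`; in the far case both classes are split into pairs, whose second
      -- entries are the levels to be added.
      distForm : Form 1
      distForm = ∃″ ∃″ ∃″ var 3F ≡″ ⟨ ⟨ var 2F , var 1F ⟩″ , var 0F ⟩″ ∧″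
        (var 2F ≡″ var 1F ∧″ var 0F ≡″ con (proj₁ 0#) ∨″
         ¬″ var 2F ≡″ var 1F ∧″
           (∃″ ⟨ var 3F , var 0F ⟩″ ∈″ con κ ∧″ ⟨ var 2F , var 0F ⟩″ ∈″ con κ) ∧″
           var 0F ≡″ con (proj₁ 1#) ∨″
         (∃″ ∃″ ∃″ ∃″
           ⟨ var 6F , ⟨ var 3F , var 2F ⟩″ ⟩″ ∈″ con κ ∧″
           ⟨ var 5F , ⟨ var 1F , var 0F ⟩″ ⟩″ ∈″ con κ ∧″
           ¬″ ⟨ var 3F , var 2F ⟩″ ≡″ ⟨ var 1F , var 0F ⟩″ ∧″
           ⟨ ⟨ var 2F , var 0F ⟩″ , var 4F ⟩″ ∈″ con add))

      ∈κ : ∀ p → ⟨ proj₁ p , proj₁ (class p) ⟩ ∈ κ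
      ∈κ (p , p∈) = image-∈ κ-function p p∈

      ∈κ⇒≡ : ∀ p {c} → ⟨ proj₁ p , c ⟩ ∈ κ → c ≡ proj₁ (class p)
      ∈κ⇒≡ (p , p∈) = ∈⇒image κ-function p∈

      distForm⇔Dist : ∀ p q v → (⟨ ⟨ proj₁ p , proj₁ q ⟩ , v ⟩ ∷ [] ⊩ distForm) ⇔ Dist p q v
      distForm⇔Dist p q v = mk⇔ ⇒ ⇐
        where
        ⇒ : (⟨ ⟨ proj₁ p , proj₁ q ⟩ , v ⟩ ∷ [] ⊩ distForm) → Dist p q v
        ⇒ (p′ , q′ , v′ , eq , cases) with ⟨⟩-injective eq
        ... | pq≡ , refl with ⟨⟩-injective pq≡
        ⇒ (_ , _ , _ , _ , inj₁ (p≈q , v≡)) | _ , refl | refl , refl = same p≈q v≡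
        ⇒ (_ , _ , _ , _ , inj₂ (inj₁ (p≉q , (c , pc∈κ , qc∈κ) , v≡))) | _ , refl | refl , refl =
          near p≉q (trans (sym (∈κ⇒≡ p pc∈κ)) (∈κ⇒≡ q qc∈κ)) v≡
        ⇒ (_ , _ , _ , _ , inj₂ (inj₂ (_ , _ , _ , _ , pc∈κ , qc∈κ , c≢ , ∈add)))
          | _ , refl | refl , refl =
          far (λ eq → c≢ (trans (∈κ⇒≡ p pc∈κ) (trans eq (sym (∈κ⇒≡ q qc∈κ)))))
              (∈add⇒≡ (lev p) (lev q)
                (subst₂ (λ r s → ⟨ ⟨ r , s ⟩ , v ⟩ ∈ add)
                   (sym (level-⟨⟩ (class p) (sym (∈κ⇒≡ p pc∈κ))))
                   (sym (level-⟨⟩ (class q) (sym (∈κ⇒≡ q qc∈κ)))) ∈add))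

        ⇐ : Dist p q v → ⟨ ⟨ proj₁ p , proj₁ q ⟩ , v ⟩ ∷ [] ⊩ distForm
        ⇐ (same p≈q v≡) = _ , _ , _ , refl , inj₁ (p≈q , v≡)
        ⇐ (near p≉q c≈c′ v≡) = _ , _ , _ , refl , inj₂ (inj₁ (p≉q ,
          (proj₁ (class p) , ∈κ p , subst (λ c → ⟨ proj₁ q , c ⟩ ∈ κ) (sym c≈c′) (∈κ q)) , v≡))
        ⇐ (far c≉c′ v≡) =
          let X , r , _ , _ , p≡ = to ∈⊗ (proj₂ (class p))
              Y , s , _ , _ , q≡ = to ∈⊗ (proj₂ (class q))
          in _ , _ , _ , refl , inj₂ (inj₂ (X , r , Y , s ,
            subst (λ c → ⟨ proj₁ p , c ⟩ ∈ κ) p≡ (∈κ p) ,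
            subst (λ c → ⟨ proj₁ q , c ⟩ ∈ κ) q≡ (∈κ q) ,
            (λ eq → c≉c′ (trans p≡ (trans eq (sym q≡)))) ,
            subst₂ (λ r s → ⟨ ⟨ r , s ⟩ , v ⟩ ∈ add)
              (level-⟨⟩ (class p) p≡) (level-⟨⟩ (class q) q≡)
              (subst (λ v → ⟨ _ , v ⟩ ∈ add) (sym v≡) (∈add (lev p) (lev q)))))

      distance-of-pair : ∀ x → (P ⊠ P) x → El R
      distance-of-pair _ (p , q , p∈P , q∈P , _) = distance (p , p∈P) (q , q∈P)

      distForm⇔distance : ∀ x (h : (P ⊠ P) x) v →
                          (⟨ x , v ⟩ ∷ [] ⊩ distForm) ⇔ (v ≡ proj₁ (distance-of-pair x h))
      distForm⇔distance _ (p , q , p∈P , q∈P , refl) v = mk⇔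
        (λ h → Dist-unique (p , p∈P) (q , q∈P) (to ⇔Dist h) (distance-Dist _ _))
        (λ { refl → from ⇔Dist (distance-Dist _ _) })
        where ⇔Dist = distForm⇔Dist (p , p∈P) (q , q∈P) v

      private module D = Definable (P ⊠ P) (P ⊗ P) R (λ x → ∈⊗) distance-of-pair
                                   distForm distForm⇔distance

      dist : V
      dist = D.set

      abstract
        dist-function : IsFunction (P ⊠ P) R dist
        dist-function = D.isFunction

      d : El P → El P → El R
      d = apply₂ dist-function

      abstract
        d-Dist : ∀ p q → Dist p q (proj₁ (d p q))
        -- Inside an abstract block `dist-function` unfolds, and its application computes to
        -- `distance`.
        d-Dist = distance-Dist

      d-cong : ∀ {p p′ q q′ : El P} → p ≈ p′ → q ≈ q′ → d p q ≈ d p′ q′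
      d-cong {p , p∈} {p′ , p′∈} {q , q∈} {q′ , q′∈} p≈p′ q≈q′ = image-cong dist-function
        (p , q , p∈ , q∈ , refl) (p′ , q′ , p′∈ , q′∈ , refl) (cong₂ ⟨_,_⟩ p≈p′ q≈q′)

      d-far : ∀ p q → ¬ class p ≈ class q → d p q ≈ lev p + lev q
      d-far p q c≉c′ = Dist-unique p q (d-Dist p q) (far c≉c′ refl)

      d≤1 : ∀ p q → class p ≈ class q → d p q ≤ 1#
      d≤1 p q c≈c′ with d-Dist p q
      ... | same _ eq   = ≤-trans (≤-reflexive eq) 0≤1
      ... | near _ _ eq = ≤-reflexive eq
      ... | far c≉c′ _  = contradiction c≈c′ c≉c′

      1≤d : ∀ p q → ¬ p ≈ q → 1# ≤ d p q
      1≤d p q p≉q with d-Dist p q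
      ... | same p≈q _  = contradiction p≈q p≉q
      ... | near _ _ eq = ≤-reflexive (sym eq)
      ... | far _ eq    = ≤-trans (≤-trans (1≤lev p) (x≤x+y (0≤lev q))) (≤-reflexive (sym eq))

      0≤d : ∀ p q → 0# ≤ d p q
      0≤d p q with proj₁ p ≟ proj₁ q
      ... | yes p≈q = ≤-reflexive (sym (Dist-unique p q (d-Dist p q) (same p≈q refl)))
      ... | no p≉q  = ≤-trans 0≤1 (1≤d p q p≉q)

      d-self : ∀ p q → p ≈ q → d p q ≈ 0#
      d-self p q p≈q = Dist-unique p q (d-Dist p q) (same p≈q refl)

      -- A distance of 1 is covered by one nontrivial leg. For a far pair, if `q` shares the class
      -- of `p` or `r`, it also shares its level, and the other leg alone has full length; otherwise
      -- the detour adds the level of `q` twice.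
      triangle : ∀ p q r → d p r ≤ d p q + d q r
      triangle p q r with d-Dist p r
      ... | same _ eq = ≤-trans (≤-trans (≤-reflexive eq) (0≤d p q)) (x≤x+y (0≤d q r))
      ... | near p≉r _ eq with proj₁ p ≟ proj₁ q
      ...   | no p≉q  = ≤-trans (≤-trans (≤-reflexive eq) (1≤d p q p≉q)) (x≤x+y (0≤d q r))
      ...   | yes p≈q = ≤-trans
        (≤-trans (≤-reflexive eq) (1≤d q r (λ q≈r → p≉r (trans p≈q q≈r)))) (x≤y+x (0≤d p q))
      triangle p q r | far c≉c′ eq
        with proj₁ (class p) ≟ proj₁ (class q) | proj₁ (class q) ≟ proj₁ (class r)
      ... | yes p~q | yes q~r = contradiction (trans p~q q~r) c≉c′
      ... | yes p~q | no q≁r = begin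
        d p r           ≈⟨ eq ⟩
        lev p + lev r   ≈⟨ +-congʳ {lev r} {lev p} {lev q} (level-cong {p = class p} {class q} p~q) ⟩
        lev q + lev r   ≈⟨ d-far q r q≁r ⟨
        d q r           ≤⟨ x≤y+x (0≤d p q) ⟩
        d p q + d q r   ∎
      ... | no p≁q | yes q~r = begin
        d p r           ≈⟨ eq ⟩
        lev p + lev r   ≈⟨ +-congˡ {lev p} {lev q} {lev r} (level-cong {p = class q} {class r} q~r) ⟨
        lev p + lev q   ≈⟨ d-far p q p≁q ⟨
        d p q           ≤⟨ x≤x+y (0≤d q r) ⟩
        d p q + d q r   ∎
      ... | no p≁q | no q≁r = begin
        d p r                              ≈⟨ eq ⟩
        lev p + lev r                      ≤⟨ +-mono-≤ (x≤x+y (0≤lev q)) (x≤y+x (0≤lev q)) ⟩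
        (lev p + lev q) + (lev q + lev r)  ≈⟨ +-cong {d p q} {lev p + lev q} {d q r} {lev q + lev r}
                                                      (d-far p q p≁q) (d-far q r q≁r) ⟨
        d p q + d q r                      ∎

      isMetric : IsGeneralMetric (_≈_ {P}) (_≈_ {R}) ℝ._≤_ 0# ℝ._+_ d
      isMetric = record
        { isSemiMetric = record
          { isQuasiSemiMetric = record
            { isPreMetric = record
              { isProtoMetric = record
                { isPartialOrder = IsTotalOrder.isPartialOrder ℝ.isTotalOrder
                ; ≈-isEquivalence = On.isEquivalence proj₁ isEquivalence
                ; cong = λ {p} {p′} {q} {q′} → d-cong {p} {p′} {q} {q′}
                ; nonNegative = λ {p} {q} → ⌊ 0≤d p q ⌋
                }
              ; ≈⇒0 = λ {p} {q} → d-self p q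
              }
            ; 0⇒≈ = λ {p} {q} → 0⇒≈ p q
            }
          ; sym = λ p q → Dist-unique p q (d-Dist p q) (Dist-sym q p (d-Dist q p))
          }
        ; triangle = λ p q r → ⌊≤+⌋ (d p r) (d p q) (d q r) (triangle p q r)
        }
        where
        0⇒≈ : ∀ p q → d p q ≈ 0# → p ≈ q
        0⇒≈ p q eq with proj₁ p ≟ proj₁ q
        ... | yes p≈q = p≈q
        ... | no p≉q  = contradiction (≤-trans (1≤d p q p≉q) (≤-reflexive eq)) 1≰0

      space : MetricSpace
      space = record
        { Point = P ; dist = dist ; dist-function = dist-function ; isMetric = isMetric }

      d≤z+z : ∀ p o {z} → 1# ≤ z → lev p ≤ z → lev o ≤ z → d p o ≤ z + z
      d≤z+z p o {z} 1≤z p≤z o≤z with d-Dist p o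
      ... | same _ eq = begin
        d p o ≈⟨ eq ⟩
        0#    ≤⟨ 0≤1 ⟩
        1#    ≤⟨ 1≤z ⟩
        z     ≤⟨ x≤x+y (≤-trans 0≤1 1≤z) ⟩
        z + z ∎
      ... | near _ _ eq = begin
        d p o ≈⟨ eq ⟩
        1#    ≤⟨ 1≤z ⟩
        z     ≤⟨ x≤x+y (≤-trans 0≤1 1≤z) ⟩
        z + z ∎
      ... | far _ eq = begin
        d p o         ≈⟨ eq ⟩
        lev p + lev o ≤⟨ +-mono-≤ p≤z o≤z ⟩
        z + z         ∎

      lev≤d : ∀ p o → ¬ class p ≈ class o → lev p ≤ d p o
      lev≤d p o p≁o = begin
        lev p         ≤⟨ x≤x+y (0≤lev o) ⟩
        lev p + lev o ≈⟨ d-far p o p≁o ⟨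
        d p o         ∎

      -- If the classes differ, the level of `p` is at most `b`, which is less than `z * z`; no
      -- level lies strictly between `z` and its square. The summand `1#` expresses strictness.
      lev≤z : ∀ p o {z b} → proj₁ z ∈ L → b + 1# ≤ z * z → lev o ≤ z → d p o ≤ b → lev p ≤ z
      lev≤z p o {z} {b} z∈L b+1≤zz o≤z d≤b = by-class (proj₁ (class p) ≟ proj₁ (class o))
        where
        too-far : ¬ class p ≈ class o → ¬ z * z ≤ lev p
        too-far p≁o zz≤p =
          x+1≰x (≤-trans b+1≤zz (≤-trans zz≤p (≤-trans (lev≤d p o p≁o) d≤b)))

        by-class : Dec (class p ≈ class o) → lev p ≤ z
        by-class (yes p~o) = ≤-trans (≤-reflexive (level-cong {p = class p} {class o} p~o)) o≤z
        by-class (no p≁o)  = [ id , (λ zz≤p → contradiction zz≤p (too-far p≁o)) ]′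
          (level-gap z (lev p) z∈L (level∈L (class p)))

    -- Inequalities for the constants of quasi-isometries.

    1*x-1≤y : ∀ {x y} → x ≤ y + 1# → 1# * x + - 1# ≤ y
    1*x-1≤y {x} h = x≤y+z⇒x-z≤y 1# (≤-trans (≤-reflexive (*-identityˡ x)) h)

    x≤1*y+1 : ∀ {x y} → x ≤ y → x ≤ 1# * y + 1#
    x≤1*y+1 {x} {y} x≤y = begin
      x           ≤⟨ x≤y ⟩
      y           ≈⟨ *-identityˡ y ⟨
      1# * y      ≤⟨ x≤x+y 0≤1 ⟩
      1# * y + 1# ∎

    4*_ : El R → El R
    4* x = x + x + x + x

    0≤4* : ∀ {x} → 0# ≤ x → 0# ≤ 4* x
    0≤4* {x} 0≤x = begin
      0#            ≤⟨ 0≤x ⟩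
      x             ≤⟨ x≤x+y 0≤x ⟩
      x + x         ≤⟨ x≤x+y 0≤x ⟩
      x + x + x     ≤⟨ x≤x+y 0≤x ⟩
      4* x          ∎

    -- Arithmetic behind the choice of threshold: the images of levels at most z
    -- under a quasi-isometry with constant N stay below the next level z * z.
    module Bounds₄ {N z : El R} (1≤N : 1# ≤ N) (4N≤z : 4* N ≤ z) where
      0≤N : 0# ≤ N
      0≤N = ≤-trans 0≤1 1≤N

      N≤z : N ≤ z
      N≤z = ≤-trans (≤-trans (x≤x+y 0≤N) (≤-trans (x≤x+y 0≤N) (x≤x+y 0≤N))) 4N≤z

      1≤z : 1# ≤ z
      1≤z = ≤-trans 1≤N N≤z

      0≤z : 0# ≤ z
      0≤z = ≤-trans 0≤1 1≤z

      N≤Nz : N ≤ N * z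
      N≤Nz = x≤x*y 0≤N 1≤z

      4Nz≤zz : 4* (N * z) ≤ z * z
      4Nz≤zz = begin
        N * z + N * z + N * z + N * z ≈⟨ +-congʳ {N * z} (+-congʳ {N * z} (distribʳ z N N)) ⟨
        (N + N) * z + N * z + N * z   ≈⟨ +-congʳ {N * z} (distribʳ z (N + N) N) ⟨
        (N + N + N) * z + N * z       ≈⟨ distribʳ z (N + N + N) N ⟨
        (4* N) * z                    ≤⟨ *-monoˡ-≤ 0≤z 4N≤z ⟩
        z * z                         ∎

      -- Points of level at most `z` are at most `z + z` apart, hence their images at most
      -- `N * (z + z) + N`. Together with the `1#` for strictness this splits into four terms of
      -- size at most `N * z`, whence the factor 4 in the threshold.
      upper-bound : N * (z + z) + N + 1# ≤ z * z
      upper-bound = begin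
        N * (z + z) + N + 1#           ≤⟨ +-mono-≤ (+-monoʳ-≤ (N * (z + z)) N≤Nz)
                                                    (≤-trans 1≤N N≤Nz) ⟩
        N * (z + z) + N * z + N * z    ≈⟨ +-congʳ {N * z} (+-congʳ {N * z} (distribˡ N z z)) ⟩
        4* (N * z)                     ≤⟨ 4Nz≤zz ⟩
        z * z                          ∎

      -- Conversely, points whose images are at most `z + z` apart are themselves at most
      -- `N * (z + z + N)` apart, see `g-lower`.
      lower-bound : N * (z + z + N) + 1# ≤ z * z
      lower-bound = begin
        N * (z + z + N) + 1#           ≈⟨ +-congʳ {1#} (distribˡ N (z + z) N) ⟩
        N * (z + z) + N * N + 1#       ≤⟨ +-mono-≤ (+-monoʳ-≤ (N * (z + z)) (*-monoʳ-≤ 0≤N N≤z))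
                                                    (≤-trans 1≤N N≤Nz) ⟩
        N * (z + z) + N * z + N * z    ≈⟨ +-congʳ {N * z} (+-congʳ {N * z} (distribˡ N z z)) ⟩
        4* (N * z)                     ≤⟨ 4Nz≤zz ⟩
        z * z                          ∎

    -- The two spaces of a family and the projection between them.

    module Family (𝒵 : V)
      (inhabited : ∀ X → X ∈ 𝒵 → ∃ λ x → x ∈ X)
      (disjoint : ∀ X Y → X ∈ 𝒵 → Y ∈ 𝒵 → X ≢ Y → ¬ (∃ λ x → x ∈ X × x ∈ Y))
      where

      ⋃𝒵 : V
      ⋃𝒵 = proj₁ (union 𝒵)

      ∈⋃ : ∀ {x} → x ∈ ⋃𝒵 ⇔ (∃ λ X → X ∈ 𝒵 × x ∈ X)
      ∈⋃ {x} = proj₂ (union 𝒵) x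

      fibre-unique : ∀ {x X Y} → X ∈ 𝒵 → Y ∈ 𝒵 → x ∈ X → x ∈ Y → X ≡ Y
      fibre-unique {x} {X} {Y} X∈𝒵 Y∈𝒵 x∈X x∈Y = by-cases (X ≟ Y)
        where
        by-cases : Dec (X ≡ Y) → X ≡ Y
        by-cases (yes X≡Y) = X≡Y
        by-cases (no X≢Y)  = contradiction (x , x∈X , x∈Y) (disjoint X Y X∈𝒵 Y∈𝒵 X≢Y)

      private
        -- `T` is the instance of `Space` whose classes are single points, so the metric axioms are
        -- verified once for both spaces, and `T.class t` computes to `t`.
        identity : ∀ t → t ∈ 𝒵 ⊗ L → El (𝒵 ⊗ L)
        identity t t∈ = t , t∈

        identityForm : Form 1
        identityForm = ∃″ var 1F ≡″ ⟨ var 0F , var 0F ⟩″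

        identity-graph : ∀ t (t∈ : t ∈ 𝒵 ⊗ L) u →
          (⟨ t , u ⟩ ∷ [] ⊩ identityForm) ⇔ (u ≡ t)
        identity-graph t _ u = mk⇔
          (λ (_ , eq) → let t≡ , u≡ = ⟨⟩-injective eq in trans u≡ (sym t≡))
          (λ { refl → t , refl })

        module Identity = Definable (_∈ 𝒵 ⊗ L) (𝒵 ⊗ L) (𝒵 ⊗ L) (λ t → mk⇔ id id)
                                    identity identityForm identity-graph

      abstract
        -- The member `X` is a witness of the union axiom. By disjointness it is the only candidate,
        -- which makes the graph definable.
        project : ∀ p → p ∈ ⋃𝒵 ⊗ L → El (𝒵 ⊗ L)
        project p p∈ =
          let x , r , x∈⋃ , r∈L , _ = to ∈⊗ p∈
              X , X∈𝒵 , _ = to ∈⋃ x∈⋃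
          in ⟨ X , r ⟩ , from ∈⊗ (X , r , X∈𝒵 , r∈L , refl)

        project-⟨⟩ : ∀ p p∈ {x r X} → p ≡ ⟨ x , r ⟩ → X ∈ 𝒵 → x ∈ X →
                     proj₁ (project p p∈) ≡ ⟨ X , r ⟩
        project-⟨⟩ p p∈ eq X∈𝒵 x∈X =
          let x′ , r′ , x∈⋃ , r∈L , eq′ = to ∈⊗ p∈
              X′ , X′∈𝒵 , x′∈X′ = to ∈⋃ x∈⋃
              x≡x′ , r≡r′ = ⟨⟩-injective (trans (sym eq) eq′)
          in cong₂ ⟨_,_⟩ (fibre-unique X′∈𝒵 X∈𝒵 x′∈X′ (subst (_∈ _) x≡x′ x∈X)) (sym r≡r′)

      projectForm : Form 1
      projectForm = ∃″ ∃″ ∃″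
        var 3F ≡″ ⟨ ⟨ var 2F , var 1F ⟩″ , ⟨ var 0F , var 1F ⟩″ ⟩″ ∧″
        var 0F ∈″ con 𝒵 ∧″ var 2F ∈″ var 0F

      coordinates : ∀ p → p ∈ ⋃𝒵 ⊗ L →
        ∃ λ x → ∃ λ r → ∃ λ X → x ∈ ⋃𝒵 × p ≡ ⟨ x , r ⟩ × X ∈ 𝒵 × x ∈ X
      coordinates p p∈ =
        let x , r , x∈⋃ , r∈L , eq = to ∈⊗ p∈
            X , X∈𝒵 , x∈X = to ∈⋃ x∈⋃
        in x , r , X , x∈⋃ , eq , X∈𝒵 , x∈X

      project-graph : ∀ p (p∈ : p ∈ ⋃𝒵 ⊗ L) u →
        (⟨ p , u ⟩ ∷ [] ⊩ projectForm) ⇔ (u ≡ proj₁ (project p p∈))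
      project-graph p p∈ u = mk⇔
        (λ (x , r , X , eq , X∈𝒵 , x∈X) →
          let p≡ , u≡ = ⟨⟩-injective eq
          in trans u≡ (sym (project-⟨⟩ p p∈ p≡ X∈𝒵 x∈X)))
        (λ u≡ → let x , r , X , _ , eq , X∈𝒵 , x∈X = coordinates p p∈ in
          x , r , X , cong₂ ⟨_,_⟩ eq (trans u≡ (project-⟨⟩ p p∈ eq X∈𝒵 x∈X)) , X∈𝒵 , x∈X)

      private module Projection = Definable (_∈ ⋃𝒵 ⊗ L) (⋃𝒵 ⊗ L) (𝒵 ⊗ L) (λ p → mk⇔ id id)
                                            project projectForm project-graph

      module T = Space 𝒵 (𝒵 ⊗ L) Identity.set Identity.isFunction
      module S = Space 𝒵 (⋃𝒵 ⊗ L) Projection.set Projection.isFunction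

      S-class-⟨⟩ : ∀ p {x r X} → proj₁ p ≡ ⟨ x , r ⟩ → X ∈ 𝒵 → x ∈ X →
                   proj₁ (S.class p) ≡ ⟨ X , r ⟩
      S-class-⟨⟩ (p , p∈) = project-⟨⟩ p p∈

      T-lev : ∀ t → T.lev t ≈ level t
      T-lev t = level-cong {p = T.class t} {t} refl

      d-class-near : ∀ p q → S.class p ≈ S.class q → T.d (S.class p) (S.class q) ≈ 0#
      d-class-near p q = T.d-self (S.class p) (S.class q)

      d-class-far : ∀ p q → ¬ S.class p ≈ S.class q → T.d (S.class p) (S.class q) ≈ S.d p q
      d-class-far p q p≁q = trans
        (T.d-far (S.class p) (S.class q) p≁q)
        (trans (+-cong {T.lev (S.class p)} {S.lev p} {T.lev (S.class q)} {S.lev q}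
                       (T-lev (S.class p)) (T-lev (S.class q)))
               (sym (S.d-far p q p≁q)))

      d-class≤ : ∀ p q → T.d (S.class p) (S.class q) ≤ S.d p q
      d-class≤ p q = by-cases (proj₁ (S.class p) ≟ proj₁ (S.class q))
        where
        by-cases : Dec (S.class p ≈ S.class q) → T.d (S.class p) (S.class q) ≤ S.d p q
        by-cases (yes p~q) = ≤-trans (≤-reflexive (d-class-near p q p~q)) (S.0≤d p q)
        by-cases (no p≁q)  = ≤-reflexive (d-class-far p q p≁q)

      d≤d-class+1 : ∀ p q → S.d p q ≤ T.d (S.class p) (S.class q) + 1#
      d≤d-class+1 p q = by-cases (proj₁ (S.class p) ≟ proj₁ (S.class q))
        where
        by-cases : Dec (S.class p ≈ S.class q) → S.d p q ≤ T.d (S.class p) (S.class q) + 1#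
        by-cases (yes p~q) = ≤-trans (S.d≤1 p q p~q) (x≤y+x (T.0≤d (S.class p) (S.class q)))
        by-cases (no p≁q)  = ≤-trans (≤-reflexive (sym (d-class-far p q p≁q))) (x≤x+y 0≤1)

      -- An element of `X` is picked for one `t` at a time. No set of the model is formed from these
      -- picks, so no choice is smuggled in.
      class-surjective : ∀ t → ∃ λ p → S.class p ≈ t
      class-surjective (t , t∈) =
        let X , r , X∈𝒵 , r∈L , eq = to ∈⊗ t∈
            x , x∈X = inhabited X X∈𝒵
            p = ⟨ x , r ⟩ , from ∈⊗ (x , r , from ∈⋃ (X , X∈𝒵 , x∈X) , r∈L , refl)
        in p , trans (S-class-⟨⟩ p refl X∈𝒵 x∈X) (sym eq)

      class-coarselyOnto :
        ∀ t → MetricSpace.Neighbourhood T.space (λ u → ∃ λ p → S.class p ≈ u) 1# t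
      -- The infimum is attained at `t`, which itself lies in the image.
      class-coarselyOnto t = 0# , (nonNegative , greatest) , ⌊ 0≤1 ⌋
        where
        Distance : Pred (El R) ℓ
        Distance s = ∃ λ u → (∃ λ p → S.class p ≈ u) × s ≈ T.d t u

        nonNegative : IsLowerBound Distance 0#
        nonNegative s (u , _ , s≈) = ⌊ ≤-trans (T.0≤d t u) (≤-reflexive {T.d t u} {s} (sym s≈)) ⌋

        greatest : ∀ l → IsLowerBound Distance l → l ℝ.≤ 0#
        greatest l l-lower = ⌊ ≤-trans {l} {T.d t t} {0#}
          ⌈ l-lower (T.d t t) (t , class-surjective t , refl) ⌉
          (≤-reflexive (T.d-self t t refl)) ⌋

      -- Only distances within a class change under the projection, and they drop by at most 1;
      -- hence the constant 1.
      class-lower : ∀ p q → 1# * S.d p q + - 1# ≤ T.d (S.class p) (S.class q)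
      class-lower p q = 1*x-1≤y {S.d p q} {T.d (S.class p) (S.class q)} (d≤d-class+1 p q)

      class-upper : ∀ p q → T.d (S.class p) (S.class q) ≤ 1# * S.d p q + 1#
      class-upper p q = x≤1*y+1 {T.d (S.class p) (S.class q)} {S.d p q} (d-class≤ p q)

      1-natural : IsNatural 1#
      1-natural I 0∈I step = subst (_∈ I) (trans (sym (+≈ℝ+ 0# 1#)) (+-identityˡ 1#)) (step 0# 0∈I)

      projection : QuasiIsometry S.space T.space
      projection = record
        { map = Projection.set
        ; map-function = Projection.isFunction
        ; N = 1#
        ; 1/N = 1#
        ; natural = 1-natural
        ; 1≤N = ⌊ ≤-refl {1#} ⌋
        ; N*1/N≈1 = trans (sym (*≈ℝ* 1# 1#)) (*-identityˡ 1#)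
        ; coarselyOnto = class-coarselyOnto
        ; lower = λ p q →
            ⌊*+≤⌋ 1# (S.d p q) (- 1#) (T.d (S.class p) (S.class q)) (class-lower p q)
        ; upper = λ p q →
            ⌊≤*+⌋ (T.d (S.class p) (S.class q)) 1# (S.d p q) 1# (class-upper p q)
        }

      -- The choice set obtained from a quasi-isometry in the other direction.

      module _ (nonempty : ∃ λ X → X ∈ 𝒵) (g : QuasiIsometry T.space S.space) where
        private module G = QuasiIsometry g
        open G using (N; 1/N)

        1≤N : 1# ≤ N
        1≤N = ⌈ G.1≤N ⌉

        0≤N : 0# ≤ N
        0≤N = ≤-trans 0≤1 1≤N

        g-upper : ∀ t u → S.d (G.f t) (G.f u) ≤ N * T.d t u + N
        g-upper t u = ⌈≤*+⌉ (S.d (G.f t) (G.f u)) N (T.d t u) N (G.upper t u)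

        g-lower : ∀ t u {b} → S.d (G.f t) (G.f u) ≤ b → T.d t u ≤ N * (b + N)
        g-lower t u {b} d≤b = begin
          T.d t u               ≈⟨ *-identityˡ (T.d t u) ⟨
          1# * T.d t u          ≈⟨ *-congʳ {T.d t u} {N * 1/N} {1#} (trans (*≈ℝ* N 1/N) G.N*1/N≈1) ⟨
          N * 1/N * T.d t u     ≈⟨ *-assoc N 1/N (T.d t u) ⟩
          N * (1/N * T.d t u)   ≤⟨ *-monoʳ-≤ {1/N * T.d t u} {b + N} 0≤N
                                     (x-z≤y⇒x≤y+z {1/N * T.d t u} N (≤-trans d-N≤d d≤b)) ⟩
          N * (b + N)           ∎
          where
          d-N≤d : 1/N * T.d t u + - N ≤ S.d (G.f t) (G.f u)
          d-N≤d = ⌈*+≤⌉ 1/N (T.d t u) (- N) (S.d (G.f t) (G.f u)) (G.lower t u)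

        -- A base point of the lowest level, hence below every threshold; distances to it and to its
        -- image control levels.
        o : El (𝒵 ⊗ L)
        o = let X₀ , X₀∈𝒵 = nonempty in
          ⟨ X₀ , proj₁ 2# ⟩ , from ∈⊗ (X₀ , proj₁ 2# , X₀∈𝒵 , 2∈L , refl)

        lev-o : T.lev o ≈ 2#
        lev-o = level-⟨⟩ (T.class o) refl

        module _ {z : El R} (z∈L : proj₁ z ∈ L) (4N≤z : 4* N ≤ z) (go≤z : S.lev (G.f o) ≤ z) where
          open Bounds₄ 1≤N 4N≤z using (1≤z; upper-bound; lower-bound)

          o≤z : T.lev o ≤ z
          o≤z = ≤-trans (≤-reflexive {T.lev o} {2#} lev-o) (2≤level z z∈L)

          -- An image above level `z` would be at least `z * z` away from the image of `o`, contrary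
          -- to `upper-bound`. The converse `g-lev≤⁻¹` mirrors this with `lower-bound`.
          g-lev≤ : ∀ t → T.lev t ≤ z → S.lev (G.f t) ≤ z
          g-lev≤ t t≤z = S.lev≤z (G.f t) (G.f o) z∈L upper-bound go≤z
            (≤-trans (g-upper t o) (+-monoˡ-≤ {N * T.d t o} {N * (z + z)} N
              (*-monoʳ-≤ {T.d t o} {z + z} 0≤N (T.d≤z+z t o 1≤z t≤z o≤z))))

          g-lev≤⁻¹ : ∀ t → S.lev (G.f t) ≤ z → T.lev t ≤ z
          g-lev≤⁻¹ t gt≤z = T.lev≤z t o z∈L lower-bound o≤z
            (g-lower t o (S.d≤z+z (G.f t) (G.f o) 1≤z gt≤z go≤z))

        threshold : ∃ λ z → proj₁ z ∈ L × 4* N ≤ z × S.lev (G.f o) ≤ z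
        threshold =
          let z , z∈L , c≤z = levels-unbounded (4* N + S.lev (G.f o))
          in z , z∈L ,
             ≤-trans (x≤x+y (S.0≤lev (G.f o))) c≤z ,
             ≤-trans (x≤y+x (0≤4* 0≤N)) c≤z

        -- The choice is made at the level following `z`, so that the level estimates hold on both
        -- sides of the gap between `z` and `r₀`.
        z r₀ : El R
        z  = proj₁ threshold
        r₀ = z * z

        z∈L : proj₁ z ∈ L
        z∈L = proj₁ (proj₂ threshold)

        r₀∈L : proj₁ r₀ ∈ L
        r₀∈L = *-closed-L z z∈L

        4N≤z : 4* N ≤ z
        4N≤z = proj₁ (proj₂ (proj₂ threshold))

        go≤z : S.lev (G.f o) ≤ z
        go≤z = proj₂ (proj₂ (proj₂ threshold))

        open Bounds₄ 1≤N 4N≤z using (0≤z; 1≤z; upper-bound; lower-bound)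

        z≤r₀ : z ≤ r₀
        z≤r₀ = x≤x*y 0≤z 1≤z

        r₀≰z : ¬ r₀ ≤ z
        r₀≰z r₀≤z = x+1≰x {z} (begin
          z + 1#      ≤⟨ +-monoʳ-≤ z 1≤z ⟩
          z + z       ≈⟨ x+x≈2x z ⟩
          2# * z      ≤⟨ *-monoˡ-≤ 0≤z (2≤level z z∈L) ⟩
          r₀          ≤⟨ r₀≤z ⟩
          z           ∎)

        -- The estimate at `r₀` keeps `t` from lying above `r₀`, the one at `z` keeps it from lying
        -- at or below `z`, and there is no level strictly in between.
        g-level-r₀ : ∀ t → S.lev (G.f t) ≈ r₀ → T.lev t ≈ r₀
        g-level-r₀ t gt≈r₀ = ≤-antisym
          (g-lev≤⁻¹ r₀∈L (≤-trans 4N≤z z≤r₀) (≤-trans go≤z z≤r₀) t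
            (≤-reflexive {S.lev (G.f t)} {r₀} gt≈r₀))
          ([ (λ t≤z → contradiction (≤-trans (≤-reflexive {r₀} {S.lev (G.f t)} (sym gt≈r₀))
                                            (g-lev≤ z∈L 4N≤z go≤z t t≤z)) r₀≰z) , id ]′
           (level-gap z (T.lev t) z∈L (level∈L (T.class t))))

        r₀≰N : ¬ r₀ ≤ N
        r₀≰N r₀≤N = x+1≰x (begin
          N + 1#                ≤⟨ +-monoˡ-≤ {N} {N * (z + z) + N} 1#
                                     (x≤y+x {N} {N * (z + z)}
                                       (*-nonNegative 0≤N (≤-trans 0≤z (x≤x+y 0≤z)))) ⟩
          N * (z + z) + N + 1#  ≤⟨ upper-bound ⟩
          r₀                    ≤⟨ r₀≤N ⟩
          N                     ∎)

        -- A point of level `r₀` is at least `r₀` away from all others, but points with images at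
        -- most 1 apart are closer than that; bounding 1 by `z + z` makes `lower-bound` applicable.
        close⇒≈ : ∀ t u → T.lev t ≈ r₀ → S.class (G.f t) ≈ S.class (G.f u) → t ≈ u
        close⇒≈ t u t≈r₀ gt~gu = by-cases (proj₁ t ≟ proj₁ u)
          where
          by-cases : Dec (t ≈ u) → t ≈ u
          by-cases (yes t≈u) = t≈u
          by-cases (no t≉u)  = contradiction (begin
            N * (z + z + N) + 1#  ≤⟨ lower-bound ⟩
            r₀                    ≈⟨ t≈r₀ ⟨
            T.lev t               ≤⟨ T.lev≤d t u t≉u ⟩
            T.d t u               ≤⟨ g-lower t u (≤-trans (S.d≤1 (G.f t) (G.f u) gt~gu)
                                                    (≤-trans 1≤z (x≤x+y 0≤z))) ⟩
            N * (z + z + N)       ∎) (x+1≰x {N * (z + z + N)})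

        at-r₀ : ∀ {X} → X ∈ 𝒵 → El (𝒵 ⊗ L)
        at-r₀ {X} X∈𝒵 = ⟨ X , proj₁ r₀ ⟩ , from ∈⊗ (X , proj₁ r₀ , X∈𝒵 , r₀∈L , refl)

        lev-at-r₀ : ∀ {X} (X∈𝒵 : X ∈ 𝒵) → T.lev (at-r₀ X∈𝒵) ≈ r₀
        lev-at-r₀ X∈𝒵 = level-⟨⟩ (T.class (at-r₀ X∈𝒵)) refl

        ∈g⇒≡ : ∀ t {c} → ⟨ proj₁ t , c ⟩ ∈ G.map → c ≡ proj₁ (G.f t)
        ∈g⇒≡ (t , t∈) = ∈⇒image G.map-function t∈

        ∈g : ∀ t → ⟨ proj₁ t , proj₁ (G.f t) ⟩ ∈ G.map
        ∈g (t , t∈) = image-∈ G.map-function t t∈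

        -- Coarse surjectivity bounds an infimum by `N` without naming a point that attains it. Were
        -- all image points at distance `r₀` or more, `r₀` would be a lower bound and therefore at
        -- most `N`.
        nearby : ∀ p → ∃ λ t → ¬ r₀ ≤ S.d p (G.f t)
        nearby p = by-cases (decide
          (∃″ ∃″ ∃″ ⟨ var 2F , var 1F ⟩″ ∈″ con G.map ∧″
                    ⟨ ⟨ con (proj₁ p) , var 1F ⟩″ , var 0F ⟩″ ∈″ con S.dist ∧″
                    ¬″ ⟨ con (proj₁ r₀) , var 0F ⟩″ ∈″ con leq) [])
          where
          Near : Set ℓ
          Near = ∃ λ t → ∃ λ u → ∃ λ v → ⟨ t , u ⟩ ∈ G.map ×
                 ⟨ ⟨ proj₁ p , u ⟩ , v ⟩ ∈ S.dist × ¬ ⟨ proj₁ r₀ , v ⟩ ∈ leq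

          ∈dist : ∀ q → ⟨ ⟨ proj₁ p , proj₁ q ⟩ , proj₁ (S.d p q) ⟩ ∈ S.dist
          ∈dist (q , q∈) = image-∈ S.dist-function _ (_ , _ , proj₂ p , q∈ , refl)

          ∈dist⇒≡ : ∀ q {v} → ⟨ ⟨ proj₁ p , proj₁ q ⟩ , v ⟩ ∈ S.dist → v ≡ proj₁ (S.d p q)
          ∈dist⇒≡ (q , q∈) = ∈⇒image S.dist-function (_ , _ , proj₂ p , q∈ , refl)

          found : Near → ∃ λ t → ¬ r₀ ≤ S.d p (G.f t)
          found (t , u , v , tu∈g , puv∈dist , r₀≰v) =
            let t′ , _ , t′∈ , _ , eq = IsFunction.graph G.map-function _ tu∈g
                t∈ = subst (_∈ _) (sym (proj₁ (⟨⟩-injective eq))) t′∈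
                u≡ = ∈g⇒≡ (t , t∈) tu∈g
                v≡ = ∈dist⇒≡ (G.f (t , t∈))
                       (subst (λ u → ⟨ ⟨ proj₁ p , u ⟩ , v ⟩ ∈ S.dist) u≡ puv∈dist)
            in (t , t∈) , λ r₀≤d →
                 r₀≰v (subst (λ v → ⟨ proj₁ r₀ , v ⟩ ∈ leq) (sym v≡) ⌊ r₀≤d ⌋)

          none : ¬ Near → ¬ MetricSpace.Neighbourhood S.space (λ q → ∃ λ t → G.f t ≈ q) N p
          none ¬near (i , (_ , greatest) , i≤N) =
            r₀≰N (≤-trans {r₀} {i} {N} ⌈ greatest r₀ r₀-lower ⌉ ⌈ i≤N ⌉)
            where
            r₀≤ : ∀ t → r₀ ≤ S.d p (G.f t)
            r₀≤ t = case (decide (⟨ con (proj₁ r₀) , con (proj₁ (S.d p (G.f t))) ⟩″ ∈″ con leq) [])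
              where
              case : Dec (⟨ proj₁ r₀ , proj₁ (S.d p (G.f t)) ⟩ ∈ leq) → r₀ ≤ S.d p (G.f t)
              case (yes r₀≤d) = ⌈ r₀≤d ⌉
              case (no r₀≰d)  = contradiction
                (proj₁ t , proj₁ (G.f t) , _ , ∈g t , ∈dist (G.f t) , r₀≰d) ¬near

            r₀-lower : ∀ s → (∃ λ q → (∃ λ t → G.f t ≈ q) × s ≈ S.d p q) → r₀ ℝ.≤ s
            r₀-lower s (q , (t , gt≈q) , s≈) = ⌊ ≤-trans (r₀≤ t) (≤-reflexive {S.d p (G.f t)} {s}
              (trans (S.d-cong {p} {p} {G.f t} {q} refl gt≈q) (sym s≈))) ⌋

          by-cases : Dec Near → ∃ λ t → ¬ r₀ ≤ S.d p (G.f t)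
          by-cases (yes near) = found near
          by-cases (no ¬near) = contradiction (G.coarselyOnto p) (none ¬near)

        -- The level `r₀` is prescribed for the argument and for the value of `g`, so the formula
        -- has no parameters besides `𝒵`, `r₀` and the graph of `g`.
        transversal : ∃ λ A → ∀ x → x ∈ A ⇔
          (x ∈ ⋃𝒵 × ∃ λ X → X ∈ 𝒵 × ⟨ ⟨ X , proj₁ r₀ ⟩ , ⟨ x , proj₁ r₀ ⟩ ⟩ ∈ G.map)
        transversal = separate
          (∃″ var 0F ∈″ con 𝒵 ∧″
              ⟨ ⟨ var 0F , con (proj₁ r₀) ⟩″ , ⟨ var 1F , con (proj₁ r₀) ⟩″ ⟩″ ∈″ con G.map)
          ⋃𝒵

        A : V
        A = proj₁ transversal

        -- Some image point is closer than `r₀` to a point over `Y` of level `r₀`, hence in the same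
        -- class. By `g-level-r₀` it comes from a point of level `r₀`, so its first coordinate
        -- qualifies.
        meets : ∀ {Y} → Y ∈ 𝒵 → ∃ λ x → x ∈ A × x ∈ Y
        meets {Y} Y∈𝒵 =
          -- `y` only serves to reach the class over `Y`; the element found in the end is the first
          -- coordinate of the image of `t`.
          let y , y∈Y = inhabited Y Y∈𝒵
              p = ⟨ y , proj₁ r₀ ⟩ ,
                  from ∈⊗ (y , proj₁ r₀ , from ∈⋃ (Y , Y∈𝒵 , y∈Y) , r₀∈L , refl)
              p~ : proj₁ (S.class p) ≡ ⟨ Y , proj₁ r₀ ⟩
              p~ = S-class-⟨⟩ p refl Y∈𝒵 y∈Y
              t , r₀≰d = nearby p
              gt~ : proj₁ (S.class (G.f t)) ≡ ⟨ Y , proj₁ r₀ ⟩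
              gt~ = trans (sym (same-class p p~ (G.f t) r₀≰d)) p~
              x , r , X , x∈⋃ , gt≡ , X∈𝒵 , x∈X = coordinates (proj₁ (G.f t)) (proj₂ (G.f t))
              X≡Y , r≡r₀ = ⟨⟩-injective (trans (sym (S-class-⟨⟩ (G.f t) gt≡ X∈𝒵 x∈X)) gt~)
              W , s , W∈𝒵 , _ , t≡ = to ∈⊗ (proj₂ t)
              s≡r₀ = trans (sym (level-⟨⟩ (T.class t) t≡))
                           (g-level-r₀ t (level-⟨⟩ (S.class (G.f t)) gt~))
              t≡Wr₀ = trans t≡ (cong ⟨ W ,_⟩ s≡r₀)
              gt≡xr₀ = trans gt≡ (cong ⟨ x ,_⟩ r≡r₀)
          in x ,
             from (proj₂ transversal x) (x∈⋃ , W , W∈𝒵 ,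
               subst₂ (λ t u → ⟨ t , u ⟩ ∈ G.map) t≡Wr₀ gt≡xr₀ (∈g t)) ,
             subst (x ∈_) X≡Y x∈X
          where
          -- Points outside the class of `p` are at least as far from `p` as its level, which is
          -- `r₀`.
          same-class : ∀ p → proj₁ (S.class p) ≡ ⟨ Y , proj₁ r₀ ⟩ → ∀ q →
                       ¬ r₀ ≤ S.d p q → S.class p ≈ S.class q
          same-class p p~ q r₀≰d = by-cases (proj₁ (S.class p) ≟ proj₁ (S.class q))
            where
            by-cases : Dec (S.class p ≈ S.class q) → S.class p ≈ S.class q
            by-cases (yes p~q) = p~q
            by-cases (no p≁q)  = contradiction
              (≤-trans (≤-reflexive {r₀} {S.lev p} (sym (level-⟨⟩ (S.class p) p~))) (S.lev≤d p q p≁q))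
              r₀≰d

        -- Both elements are first coordinates of images in the class over `Y`. By `close⇒≈` the two
        -- arguments of `g` agree, and `g` is single-valued.
        meets-once : ∀ {Y x y} → Y ∈ 𝒵 → x ∈ A × x ∈ Y → y ∈ A × y ∈ Y → x ≡ y
        meets-once {Y} {x} {y} Y∈𝒵 (x∈A , x∈Y) (y∈A , y∈Y) =
          let _ , X , X∈𝒵 , Xx∈g = to (proj₂ transversal x) x∈A
              _ , W , W∈𝒵 , Wy∈g = to (proj₂ transversal y) y∈A
              t = at-r₀ X∈𝒵
              u = at-r₀ W∈𝒵
              gt≡ = sym (∈g⇒≡ t Xx∈g)
              gu≡ = sym (∈g⇒≡ u Wy∈g)
              t≈u = close⇒≈ t u (lev-at-r₀ X∈𝒵)
                      (trans (S-class-⟨⟩ (G.f t) gt≡ Y∈𝒵 x∈Y)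
                             (sym (S-class-⟨⟩ (G.f u) gu≡ Y∈𝒵 y∈Y)))
              gt≈gu = image-cong G.map-function (proj₂ t) (proj₂ u) t≈u
          in proj₁ (⟨⟩-injective (trans (sym gt≡) (trans gt≈gu gu≡)))

      choose : (∃ λ X → X ∈ 𝒵) → QuasiIsometrySymmetric →
               ∃ λ A → ∀ X → X ∈ 𝒵 → ∃! _≡_ λ x → x ∈ A × x ∈ X
      choose nonempty symmetric = A nonempty g , λ X X∈𝒵 →
        let x , x∈ = meets nonempty g X∈𝒵 in x , x∈ , meets-once nonempty g X∈𝒵 x∈
        where
        g : QuasiIsometry T.space S.space
        g = symmetric S.space T.space projection

    choice : QuasiIsometrySymmetric → AxiomOfChoice
    choice symmetric 𝒵 nonempty inhabited disjoint =
      Family.choose 𝒵 inhabited disjoint nonempty symmetric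

corollary2 : ∀ {ℓ : Level} (M : ZF ℓ) (ℝ : Internal.Reals M) →
    Internal.Metric.QuasiIsometrySymmetric M ℝ →
    Internal.AxiomOfChoice M
corollary2 M ℝ = choice M ℝ
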